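{- For $n \ge 1$ let $\mathfrak{D}_n := \operatorname{denom}(B_n(x))$. Then: (i) if $n = 1$, $\mathfrak{D}_n = 2$; (ii) if $n \ge 3$ is odd, $\displaystyle \mathfrak{D}_n = \prod_{\substack{p \le \frac{n+1}{2} \\ s_p(n) \ge p}} p$; (iii) if $n \ge 2$ is even, $\displaystyle \mathfrak{D}_n = \prod_{(p-1) \mid n} p \;\times \prod_{\substack{(p-1) \nmid n \\ p \le \frac{n+1}{3} \\ s_p(n) \ge p}} p$, where all products run over primes $p$. In particular, $\mathfrak{D}_n$ is even and squarefree for all $n \ge 1$, and the sequence $(\mathfrak{D}_n)_{n \ge 1}$ is unbounded. Moreover, $\operatorname{denom}(B_n) \mid \operatorname{denom}(B_n(x))$ for all $n \ge 1$.
   Context: The Bernoulli numbers $B_k$ are defined by $\frac{t}{e^t-1} = \sum_{k\ge 0} B_k \frac{t^k}{k!}$ ($|t|<2\pi$), and the Bernoulli polynomials by $B_n(x) = \sum_{k=0}^n \binom{n}{k} B_k x^{n-k}$. For a rational number $\rho=\nu/\delta$ in lowest terms ($\nu\in\mathbb{Z}$, $\delta\in\mathbb{N}$), $\operatorname{denom}(\rho) := \delta$; for a polynomial $f(x) \in \mathbb{Q}[x]$, $\operatorname{denom}(f(x))$ is the smallest positive integer $d$ with $d\, f(x) \in \mathbb{Z}[x]$. For a prime $p$ and integer $x\ge0$ with base-$p$ digits $\alpha_0,\dots,\alpha_r$ (i.e. $x=\sum \alpha_j p^j$, $0\le\alpha_j\le p-1$), $s_p(x) := \sum_j \alpha_j$.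 -}

module Defs where

open import Data.Nat as ℕ using (ℕ; zero; suc; _∸_; _%_; _≤_; _!)
open import Data.Nat.Properties using (_!≢0)
open import Data.Nat.Combinatorics using (_C_)
open import Data.Nat.Divisibility using (_∣_; _∣?_)
open import Data.Nat.Primality using (Prime; prime?)
open import Data.Integer using (+_)
open import Data.Rational as ℚ using (ℚ; ↧ₙ_; _/_)
open import Data.List using (List; []; _∷_; _++_; [_]; map; zipWith; upTo; foldr; filter; length)
open import Data.Nat.ListAction using (product)
open import Data.List.Relation.Unary.All using (All)
open import Data.Product using (_×_)
open import Relation.Binary.PropositionalEquality using (_≡_)
open import Relation.Unary using (Pred; Decidable)
open import Relation.Nullary.Decidable using (_×-dec_; ¬?)
open import Relation.Nullary using (¬_)
open import Level using (0ℓ)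

sumℚ : List ℚ → ℚ
sumℚ = foldr ℚ._+_ ℚ.0ℚ

-- Coefficients of the formal power series  t/(e^t - 1) = Σ c_k t^k.
-- Since (e^t - 1)/t = Σ_k t^k/(k+1)!, these are determined by
--   Σ_{k=0}^{n} c_k / (n-k+1)! = [n = 0].
-- coeffs n = [c_0, c_1, ..., c_n].
coeffs : ℕ → List ℚ
coeffs zero = [ ℚ.1ℚ ]
coeffs (suc n) = cs ++ [ ℚ.- sumℚ (zipWith term (upTo (suc n)) cs) ]
  where
  cs : List ℚ
  cs = coeffs n
  term : ℕ → ℚ → ℚ
  term k c = c ℚ.* ((+ 1 / ((suc (suc n) ∸ k) !)) {{(suc (suc n) ∸ k) !≢0}})

lastOr : ℚ → List ℚ → ℚ
lastOr d [] = d
lastOr d (x ∷ xs) = lastOr x xs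

-- Bernoulli number B_n = n! · c_n  (so t/(e^t-1) = Σ B_k t^k / k!).
bernoulli : ℕ → ℚ
bernoulli n = ((+ (n !)) / 1) ℚ.* lastOr ℚ.0ℚ (coeffs n)

-- Bernoulli polynomial B_n(x) = Σ_{k=0}^n C(n,k) B_k x^{n-k}, as the list of
-- its coefficients in ascending degree: coefficient of x^j is C(n,n-j) B_{n-j}.
bernoulliPoly : ℕ → List ℚ
bernoulliPoly n = map (λ j → ((+ (n C (n ∸ j))) / 1) ℚ.* bernoulli (n ∸ j)) (upTo (suc n))

IsIntegral : ℚ → Set
IsIntegral q = ↧ₙ q ≡ 1

ScalesToℤ[x] : ℕ → List ℚ → Set
ScalesToℤ[x] d f = All (λ a → IsIntegral (((+ d) / 1) ℚ.* a)) f

IsDenomPoly : List ℚ → ℕ → Set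
IsDenomPoly f d = 0 ℕ.< d × ScalesToℤ[x] d f × (∀ e → 0 ℕ.< e → ScalesToℤ[x] e f → d ≤ e)

-- Sum of base-p digits s_p(n) (for p ≥ 2; junk value 0 for p < 2).
-- Fuel n suffices since the number at least halves at each step.
digitSum : ℕ → ℕ → ℕ
digitSum zero n = 0
digitSum (suc zero) n = 0
digitSum p@(suc (suc q)) n = go n n
  where
  go : ℕ → ℕ → ℕ
  go zero m = 0
  go (suc f) m = m % p ℕ.+ go f (m ℕ./ p)

primeProd : (N : ℕ) (P : Pred ℕ 0ℓ) → Decidable P → ℕ
primeProd N P P? = product (filter (λ p → prime? p ×-dec P? p) (upTo (suc N)))

CondOdd : ℕ → Pred ℕ 0ℓ
CondOdd n p = 2 ℕ.* p ≤ n ℕ.+ 1 × p ≤ digitSum p n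

condOdd? : ∀ n → Decidable (CondOdd n)
condOdd? n p = (2 ℕ.* p ℕ.≤? n ℕ.+ 1) ×-dec (p ℕ.≤? digitSum p n)

CondDiv : ℕ → Pred ℕ 0ℓ
CondDiv n p = (p ∸ 1) ∣ n

condDiv? : ∀ n → Decidable (CondDiv n)
condDiv? n p = (p ∸ 1) ∣? n

CondEven : ℕ → Pred ℕ 0ℓ
CondEven n p = (¬ ((p ∸ 1) ∣ n)) × 3 ℕ.* p ≤ n ℕ.+ 1 × p ≤ digitSum p n

condEven? : ∀ n → Decidable (CondEven n)
condEven? n p = ¬? ((p ∸ 1) ∣? n) ×-dec ((3 ℕ.* p ℕ.≤? n ℕ.+ 1) ×-dec (p ℕ.≤? digitSum p n))

SquareFree : ℕ → Set
SquareFree d = ∀ m → m ℕ.* m ∣ d → m ≡ 1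

{-# OPTIONS --safe #-}
module Submission where

-- The proof is local at each prime p. With S_n = Σ_{a<p} a^n, the identity
-- (Σ_{a<p} e^{at}) = t/(e^t − 1) · (e^{pt} − 1)/t expresses p B_n as S_n plus
-- multiples of the p B_k with k < n. The coefficients are p-integral, and divisible
-- by p apart from the coefficient n of p B_{n−1} when p = 2. Hence p B_n is p-integral
-- and p B_n ≡ S_n (mod p), unless p = 2 and n is odd. As S_n ≡ −1
-- or 0 according to whether p − 1 divides n > 0, the coefficient C(n,k) B_k, for p
-- odd and k > 0, has a pole at p exactly when p − 1 ∣ k and p ∤ C(n,k). By Lucas
-- the latter says that k arises from n by lowering base-p digits, and since
-- k ≡ s_p(k) (mod p − 1), such a k with 0 < k < n exists if and only if
-- s_p(n) ≥ p. The remaining candidate k = n gives the condition p − 1 ∣ n,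
-- and p = 2 always occurs, through k = n (n even) or k = 1 (n odd).

-- The coefficients in question come from p^k/(k + 1), the sequence of (e^{pt} - 1)/(pt). Since k +
-- 1 < p^(k+1), the power p^k absorbs the p-part of k + 1; for k > 0 a further factor p remains,
-- except for p = 2 and k = 1, where the value is 2/2 = 1. This single unit is what separates p = 2
-- from the odd primes, and for odd n it is the coefficient -n/2 that supplies the pole at 2. As
-- pB_k is p-integral for every k, all poles are simple: this makes the denominator squarefree, so
-- that one pole decides whether a prime occurs. The algebra of exponential series is set up over a
-- commutative semiring because it serves twice: over ℚ for the Bernoulli numbers, and over ℕ for
-- the power sums, where (e^t - 1) Σ_{a<p} e^{at} = e^{pt} - 1 yields S_n ≡ 0 for n < p - 1.

open import Level using (0ℓ)
open import Data.Nat as ℕ using (ℕ; zero; suc; _≤_; _<_; z≤n; s≤s)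
open import Data.Nat.Properties as ℕₚ using (_!≢0)
open import Function using (_∘_; id; case_of_)
open import Algebra.Bundles using (CommutativeSemiring; module CommutativeRing)
import Algebra.Solver.Ring.NaturalCoefficients.Default as NatSolver
import Relation.Binary.Reasoning.Setoid as SetoidReasoning

-- Algebra of exponential power series.

-- Sequences (a_n) stand for the exponential series Σ a_n t^n / n!.
module Hurwitz (R : CommutativeSemiring 0ℓ 0ℓ) where

  infixl 7 _⋆_

  open CommutativeSemiring R renaming (Carrier to A)
  open SetoidReasoning setoid
  open NatSolver R using (solve; _:=_; _:+_; _:*_; con)

  -- The Leibniz rule (FG)' = F'G + FG', since differentiating an exponential series shifts its
  -- sequence. Binomial convolution is thus defined without binomial coefficients, and its laws
  -- follow by induction on the index for all sequences at once.
  _⋆_ : (ℕ → A) → (ℕ → A) → ℕ → A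
  (f ⋆ g) zero    = f 0 * g 0
  (f ⋆ g) (suc n) = (f ∘ suc ⋆ g) n + (f ⋆ g ∘ suc) n

  ⋆-cong : ∀ {f f′ g g′} → (∀ n → f n ≈ f′ n) → (∀ n → g n ≈ g′ n) → ∀ n → (f ⋆ g) n ≈ (f′ ⋆ g′) n
  ⋆-cong p q zero    = *-cong (p 0) (q 0)
  ⋆-cong p q (suc n) = +-cong (⋆-cong (p ∘ suc) q n) (⋆-cong p (q ∘ suc) n)

  ⋆-distribʳ : ∀ f f′ g n → ((λ k → f k + f′ k) ⋆ g) n ≈ (f ⋆ g) n + (f′ ⋆ g) n
  ⋆-distribʳ f f′ g zero = solve 3 (λ x y z → (x :+ y) :* z := x :* z :+ y :* z) refl (f 0) (f′ 0) (g 0)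
  ⋆-distribʳ f f′ g (suc n) = trans
    (+-cong (⋆-distribʳ (f ∘ suc) (f′ ∘ suc) g n) (⋆-distribʳ f f′ (g ∘ suc) n))
    (solve 4 (λ x y z w → (x :+ y) :+ (z :+ w) := (x :+ z) :+ (y :+ w)) refl _ _ _ _)

  ⋆-distribˡ : ∀ f g g′ n → (f ⋆ (λ k → g k + g′ k)) n ≈ (f ⋆ g) n + (f ⋆ g′) n
  ⋆-distribˡ f g g′ zero = solve 3 (λ x y z → x :* (y :+ z) := x :* y :+ x :* z) refl (f 0) (g 0) (g′ 0)
  ⋆-distribˡ f g g′ (suc n) = trans
    (+-cong (⋆-distribˡ (f ∘ suc) g g′ n) (⋆-distribˡ f (g ∘ suc) (g′ ∘ suc) n))
    (solve 4 (λ x y z w → (x :+ y) :+ (z :+ w) := (x :+ z) :+ (y :+ w)) refl _ _ _ _)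

  ⋆-scaleˡ : ∀ c f g n → ((λ k → c * f k) ⋆ g) n ≈ c * (f ⋆ g) n
  ⋆-scaleˡ c f g zero = solve 3 (λ x y z → x :* y :* z := x :* (y :* z)) refl c (f 0) (g 0)
  ⋆-scaleˡ c f g (suc n) = trans
    (+-cong (⋆-scaleˡ c (f ∘ suc) g n) (⋆-scaleˡ c f (g ∘ suc) n))
    (solve 3 (λ x y z → x :* y :+ x :* z := x :* (y :+ z)) refl c _ _)

  ⋆-scaleʳ : ∀ c f g n → (f ⋆ (λ k → c * g k)) n ≈ c * (f ⋆ g) n
  ⋆-scaleʳ c f g zero = solve 3 (λ x y z → y :* (x :* z) := x :* (y :* z)) refl c (f 0) (g 0)
  ⋆-scaleʳ c f g (suc n) = trans
    (+-cong (⋆-scaleʳ c (f ∘ suc) g n) (⋆-scaleʳ c f (g ∘ suc) n))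
    (solve 3 (λ x y z → x :* y :+ x :* z := x :* (y :+ z)) refl c _ _)

  ⋆-assoc : ∀ f g h n → ((f ⋆ g) ⋆ h) n ≈ (f ⋆ (g ⋆ h)) n
  ⋆-assoc f g h zero = solve 3 (λ x y z → x :* y :* z := x :* (y :* z)) refl (f 0) (g 0) (h 0)
  ⋆-assoc f g h (suc n) = begin
    ((λ k → (f ∘ suc ⋆ g) k + (f ⋆ g ∘ suc) k) ⋆ h) n + ((f ⋆ g) ⋆ h ∘ suc) n
      ≈⟨ +-congʳ (⋆-distribʳ (f ∘ suc ⋆ g) (f ⋆ g ∘ suc) h n) ⟩
    ((f ∘ suc ⋆ g) ⋆ h) n + ((f ⋆ g ∘ suc) ⋆ h) n + ((f ⋆ g) ⋆ h ∘ suc) n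
      ≈⟨ +-cong (+-cong (⋆-assoc (f ∘ suc) g h n) (⋆-assoc f (g ∘ suc) h n)) (⋆-assoc f g (h ∘ suc) n) ⟩
    (f ∘ suc ⋆ (g ⋆ h)) n + (f ⋆ (g ∘ suc ⋆ h)) n + (f ⋆ (g ⋆ h ∘ suc)) n
      ≈⟨ solve 3 (λ x y z → x :+ y :+ z := x :+ (y :+ z)) refl _ _ _ ⟩
    (f ∘ suc ⋆ (g ⋆ h)) n + ((f ⋆ (g ∘ suc ⋆ h)) n + (f ⋆ (g ⋆ h ∘ suc)) n)
      ≈⟨ +-congˡ (⋆-distribˡ f (g ∘ suc ⋆ h) (g ⋆ h ∘ suc) n) ⟨
    (f ∘ suc ⋆ (g ⋆ h)) n + (f ⋆ (λ k → (g ∘ suc ⋆ h) k + (g ⋆ h ∘ suc) k)) n ∎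

  ι : ℕ → A
  ι zero    = 0#
  ι (suc n) = 1# + ι n

  0̂ δ X : ℕ → A
  0̂ _       = 0#
  δ zero    = 1#
  δ (suc n) = 0#
  X zero    = 0#
  X (suc n) = δ n

  E : A → ℕ → A
  E a zero    = 1#
  E a (suc n) = a * E a n

  ⋆-zeroˡ : ∀ g n → (0̂ ⋆ g) n ≈ 0#
  ⋆-zeroˡ g zero    = zeroˡ (g 0)
  ⋆-zeroˡ g (suc n) = trans (+-cong (⋆-zeroˡ g n) (⋆-zeroˡ (g ∘ suc) n)) (+-identityˡ 0#)

  ⋆-zeroʳ : ∀ f n → (f ⋆ 0̂) n ≈ 0#
  ⋆-zeroʳ f zero    = zeroʳ (f 0)
  ⋆-zeroʳ f (suc n) = trans (+-cong (⋆-zeroʳ (f ∘ suc) n) (⋆-zeroʳ f n)) (+-identityˡ 0#)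

  ⋆-identityˡ : ∀ g n → (δ ⋆ g) n ≈ g n
  ⋆-identityˡ g zero    = *-identityˡ (g 0)
  ⋆-identityˡ g (suc n) = trans (+-cong (⋆-zeroˡ g n) (⋆-identityˡ (g ∘ suc) n)) (+-identityˡ _)

  ⋆-comm : ∀ f g n → (f ⋆ g) n ≈ (g ⋆ f) n
  ⋆-comm f g zero    = solve 2 (λ x y → x :* y := y :* x) refl (f 0) (g 0)
  ⋆-comm f g (suc n) = trans (+-cong (⋆-comm (f ∘ suc) g n) (⋆-comm f (g ∘ suc) n))
    (solve 2 (λ x y → x :+ y := y :+ x) refl _ _)

  X⋆-zero : ∀ f → (X ⋆ f) 0 ≈ 0#
  X⋆-zero f = zeroˡ (f 0)

  -- The index appears as a factor because the series are exponential. It accounts for the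
  -- denominators k + 1 of (e^t - 1)/t, and for the factor n + 1 in front of S_n when power sums are
  -- compared.
  X⋆-suc : ∀ f n → (X ⋆ f) (suc n) ≈ ι (suc n) * f n
  X⋆-suc f zero = solve 2 (λ x y → con 1 :* x :+ con 0 :* y := (con 1 :+ con 0) :* x) refl (f 0) (f 1)
  X⋆-suc f (suc n) = begin
    (δ ⋆ f) (suc n) + (X ⋆ f ∘ suc) (suc n) ≈⟨ +-cong (⋆-identityˡ f (suc n)) (X⋆-suc (f ∘ suc) n) ⟩
    f (suc n) + ι (suc n) * f (suc n)       ≈⟨ solve 2 (λ x y → y :+ x :* y := (con 1 :+ x) :* y) refl _ _ ⟩
    ι (suc (suc n)) * f (suc n)             ∎

  E-⋆ : ∀ a b n → (E a ⋆ E b) n ≈ E (a + b) n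
  E-⋆ a b zero    = *-identityˡ 1#
  E-⋆ a b (suc n) = begin
    ((λ k → a * E a k) ⋆ E b) n + (E a ⋆ (λ k → b * E b k)) n
      ≈⟨ +-cong (⋆-scaleˡ a (E a) (E b) n) (⋆-scaleʳ b (E a) (E b) n) ⟩
    a * (E a ⋆ E b) n + b * (E a ⋆ E b) n
      ≈⟨ solve 3 (λ x y z → x :* z :+ y :* z := (x :+ y) :* z) refl a b _ ⟩
    (a + b) * (E a ⋆ E b) n
      ≈⟨ *-congˡ (E-⋆ a b n) ⟩
    (a + b) * E (a + b) n ∎

  powerSum : ℕ → ℕ → A
  powerSum zero    k = 0#
  powerSum (suc N) k = powerSum N k + E (ι N) k

  -- (e^t − 1) Σ_{a<N} e^{at} = e^{Nt} − 1, with J = e^t − 1.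
  J⋆powerSum : ∀ J → (∀ n → J n + δ n ≈ E 1# n) → ∀ N n → (J ⋆ powerSum N) n + δ n ≈ E (ι N) n
  J⋆powerSum J J+δ zero n = trans (+-congʳ (⋆-zeroʳ J n)) (trans (+-identityˡ (δ n)) (δ≈E0 n))
    where
    δ≈E0 : ∀ n → δ n ≈ E 0# n
    δ≈E0 zero    = refl
    δ≈E0 (suc n) = sym (zeroˡ _)
  J⋆powerSum J J+δ (suc N) n = begin
    (J ⋆ powerSum (suc N)) n + δ n
      ≈⟨ +-congʳ (⋆-distribˡ J (powerSum N) (E (ι N)) n) ⟩
    (J ⋆ powerSum N) n + (J ⋆ E (ι N)) n + δ n
      ≈⟨ solve 3 (λ x y z → x :+ y :+ z := y :+ (x :+ z)) refl _ _ _ ⟩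
    (J ⋆ E (ι N)) n + ((J ⋆ powerSum N) n + δ n)
      ≈⟨ +-congˡ (J⋆powerSum J J+δ N n) ⟩
    (J ⋆ E (ι N)) n + E (ι N) n
      ≈⟨ +-congˡ (⋆-identityˡ (E (ι N)) n) ⟨
    (J ⋆ E (ι N)) n + (δ ⋆ E (ι N)) n
      ≈⟨ ⋆-distribʳ J δ (E (ι N)) n ⟨
    ((λ k → J k + δ k) ⋆ E (ι N)) n
      ≈⟨ ⋆-cong J+δ (λ _ → refl) n ⟩
    (E 1# ⋆ E (ι N)) n
      ≈⟨ E-⋆ 1# (ι N) n ⟩
    E (ι (suc N)) n ∎

  -- Serves both p-integrality and divisibility by p. The variants ask less of `f` when `g` has
  -- order at least 1 or 2; this is what makes strong induction on the index possible.
  module Ideal {F G I : A → Set} (I-resp : ∀ {x y} → x ≈ y → I x → I y) (I-0 : I 0#)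
    (I-+ : ∀ {x y} → I x → I y → I (x + y)) (I-* : ∀ {x y} → F x → G y → I (x * y)) where

    ⋆-closed : ∀ f g n → (∀ k → k ≤ n → F (f k)) → (∀ k → G (g k)) → I ((f ⋆ g) n)
    ⋆-closed f g zero    Ff Gg = I-* (Ff 0 z≤n) (Gg 0)
    ⋆-closed f g (suc n) Ff Gg = I-+
      (⋆-closed (f ∘ suc) g n (λ k k≤n → Ff (suc k) (s≤s k≤n)) Gg)
      (⋆-closed f (g ∘ suc) n (λ k k≤n → Ff k (ℕₚ.m≤n⇒m≤1+n k≤n)) (Gg ∘ suc))

    ⋆-closed₁ : ∀ f g n → g 0 ≈ 0# → (∀ k → k < n → F (f k)) → (∀ k → G (g k)) → I ((f ⋆ g) n)
    ⋆-closed₁ f g zero    g0 Ff Gg = I-resp (sym (trans (*-congˡ g0) (zeroʳ (f 0)))) I-0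
    ⋆-closed₁ f g (suc n) g0 Ff Gg = I-+
      (⋆-closed₁ (f ∘ suc) g n g0 (λ k k<n → Ff (suc k) (s≤s k<n)) Gg)
      (⋆-closed f (g ∘ suc) n (λ k k≤n → Ff k (s≤s k≤n)) (Gg ∘ suc))

    ⋆-closed₂ : ∀ f g n → g 0 ≈ 0# → g 1 ≈ 0# → (∀ k → suc k < n → F (f k)) → (∀ k → G (g k)) → I ((f ⋆ g) n)
    ⋆-closed₂ f g zero    g0 g1 Ff Gg = I-resp (sym (trans (*-congˡ g0) (zeroʳ (f 0)))) I-0
    ⋆-closed₂ f g (suc n) g0 g1 Ff Gg = I-+
      (⋆-closed₂ (f ∘ suc) g n g0 g1 (λ k k<n → Ff (suc k) (s≤s k<n)) Gg)
      (⋆-closed₁ f (g ∘ suc) n g1 (λ k k<n → Ff k (s≤s k<n)) (Gg ∘ suc))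

  -- Ordinary power series and their passage to exponential ones.

  conv : (ℕ → A) → (ℕ → A) → ℕ → A
  conv f g zero    = f 0 * g 0
  conv f g (suc n) = f 0 * g (suc n) + conv (f ∘ suc) g n

  conv-cong : ∀ {f f′ g g′} → (∀ n → f n ≈ f′ n) → (∀ n → g n ≈ g′ n) → ∀ n → conv f g n ≈ conv f′ g′ n
  conv-cong p q zero    = *-cong (p 0) (q 0)
  conv-cong p q (suc n) = +-cong (*-cong (p 0) (q (suc n))) (conv-cong (p ∘ suc) q n)

  conv-distribʳ : ∀ f f′ g n → conv (λ k → f k + f′ k) g n ≈ conv f g n + conv f′ g n
  conv-distribʳ f f′ g zero = solve 3 (λ x y z → (x :+ y) :* z := x :* z :+ y :* z) refl (f 0) (f′ 0) (g 0)
  conv-distribʳ f f′ g (suc n) = trans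
    (+-congˡ (conv-distribʳ (f ∘ suc) (f′ ∘ suc) g n))
    (solve 5 (λ x y z u v → (x :+ y) :* z :+ (u :+ v) := (x :* z :+ u) :+ (y :* z :+ v))
      refl (f 0) (f′ 0) (g (suc n)) _ _)

  D : (ℕ → A) → ℕ → A
  D f n = ι (suc n) * f (suc n)

  leibniz : ∀ f g n → ι (suc n) * conv f g (suc n) ≈ conv (D f) g n + conv f (D g) n
  leibniz f g zero = solve 4 (λ f₀ f₁ g₀ g₁ →
      (con 1 :+ con 0) :* (f₀ :* g₁ :+ f₁ :* g₀) := (con 1 :+ con 0) :* f₁ :* g₀ :+ f₀ :* ((con 1 :+ con 0) :* g₁))
    refl (f 0) (f 1) (g 0) (g 1)
  leibniz f g (suc n) = begin
    (1# + ι (suc n)) * (f 0 * g (suc (suc n)) + conv (f ∘ suc) g (suc n))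
      ≈⟨ solve 4 (λ m a b c → (con 1 :+ m) :* (a :* b :+ c) := m :* c :+ c :+ a :* ((con 1 :+ m) :* b))
           refl (ι (suc n)) (f 0) _ _ ⟩
    ι (suc n) * conv (f ∘ suc) g (suc n) + conv (f ∘ suc) g (suc n) + f 0 * D g (suc n)
      ≈⟨ +-congʳ (+-congʳ (leibniz (f ∘ suc) g n)) ⟩
    conv (D (f ∘ suc)) g n + conv (f ∘ suc) (D g) n + (f 1 * g (suc n) + conv (f ∘ suc ∘ suc) g n) + f 0 * D g (suc n)
      ≈⟨ solve 6 (λ p q x y r s → p :+ q :+ (x :* y :+ r) :+ s := (con 1 :+ con 0) :* x :* y :+ (p :+ r) :+ (s :+ q))
           refl _ _ (f 1) (g (suc n)) _ _ ⟩
    D f 0 * g (suc n) + (conv (D (f ∘ suc)) g n + conv (f ∘ suc ∘ suc) g n) + (f 0 * D g (suc n) + conv (f ∘ suc) (D g) n)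
      ≈⟨ +-congʳ (+-congˡ (conv-distribʳ (D (f ∘ suc)) (f ∘ suc ∘ suc) g n)) ⟨
    D f 0 * g (suc n) + conv (λ k → D (f ∘ suc) k + f (suc (suc k))) g n + (f 0 * D g (suc n) + conv (f ∘ suc) (D g) n)
      ≈⟨ +-congʳ (+-congˡ
           (conv-cong (λ k → solve 2 (λ m x → m :* x :+ x := (con 1 :+ m) :* x) refl (ι (suc k)) _) (λ _ → refl) n)) ⟩
    D f 0 * g (suc n) + conv (D f ∘ suc) g n + (f 0 * D g (suc n) + conv (f ∘ suc) (D g) n) ∎

  factorial : ℕ → A
  factorial zero    = 1#
  factorial (suc n) = ι (suc n) * factorial n

  hat : (ℕ → A) → ℕ → A
  hat f n = factorial n * f n

  hat-D : ∀ f n → hat (D f) n ≈ hat f (suc n)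
  hat-D f n = solve 3 (λ x y z → x :* (y :* z) := y :* x :* z) refl _ _ _

  -- Both products obey a Leibniz rule and `hat` turns the derivative `D` into the shift, so the
  -- induction step uses the pairs `D f`, `g` and `f`, `D g`.
  hat-conv : ∀ f g n → factorial n * conv f g n ≈ (hat f ⋆ hat g) n
  hat-conv f g zero = solve 2 (λ x y → con 1 :* (x :* y) := (con 1 :* x) :* (con 1 :* y)) refl (f 0) (g 0)
  hat-conv f g (suc n) = begin
    ι (suc n) * factorial n * conv f g (suc n)
      ≈⟨ solve 3 (λ x y z → x :* y :* z := y :* (x :* z)) refl _ _ _ ⟩
    factorial n * (ι (suc n) * conv f g (suc n))
      ≈⟨ *-congˡ (leibniz f g n) ⟩
    factorial n * (conv (D f) g n + conv f (D g) n)
      ≈⟨ solve 3 (λ x y z → x :* (y :+ z) := x :* y :+ x :* z) refl _ _ _ ⟩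
    factorial n * conv (D f) g n + factorial n * conv f (D g) n
      ≈⟨ +-cong (hat-conv (D f) g n) (hat-conv f (D g) n) ⟩
    (hat (D f) ⋆ hat g) n + (hat f ⋆ hat (D g)) n
      ≈⟨ +-cong (⋆-cong (hat-D f) (λ _ → refl) n) (⋆-cong (λ _ → refl) (hat-D g) n) ⟩
    (hat f ∘ suc ⋆ hat g) n + (hat f ⋆ hat g ∘ suc) n ∎

open import Defs
open import Data.Nat using (_+_; _*_; _∸_; _^_; _!)
open import Data.Nat.Combinatorics using (_C_; nCn≡1; nC1≡n)
open import Data.Nat.Divisibility
open import Data.Nat.Primality
open import Data.Nat.Induction using (<-rec)
open import Data.Nat.ListAction using (product)
open import Data.Nat.ListAction.Properties using (product-++; ∈⇒∣product)
open import Data.List using (List; []; _∷_; _++_; _∷ʳ_; zipWith; upTo; applyUpTo; filter)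
open import Data.List.Properties using (applyUpTo-∷ʳ)
open import Data.List.Relation.Unary.All as All using (All; []; _∷_)
import Data.List.Relation.Unary.All.Properties as All
open import Data.List.Relation.Unary.Any using (Any; here; there)
open import Data.List.Relation.Unary.AllPairs using ([]; _∷_)
open import Data.List.Relation.Unary.Unique.Propositional using (Unique)
import Data.List.Relation.Unary.Unique.Propositional.Properties as Unique
open import Data.List.Membership.Propositional using (_∈_; _∉_; lose; find)
open import Data.List.Membership.Propositional.Properties
  using (∈-filter⁺; ∈-filter⁻; ∈-upTo⁺; ∈-++⁺ˡ; ∈-++⁺ʳ; ∈-++⁻)
open import Data.List.Membership.DecPropositional ℕ._≟_ using (_∈?_)
open import Data.Product using (_×_; _,_; _,′_; proj₁; proj₂; ∃-syntax)
open import Data.Sum using (_⊎_; inj₁; inj₂; [_,_]′)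
open import Data.Unit using (⊤; tt)
open import Relation.Nullary using (¬_; yes; no; contradiction)
open import Relation.Nullary.Decidable using (_×-dec_; _⊎-dec_; decidable-stable)
open import Relation.Unary using (Decidable; Pred)
open import Relation.Binary.Bundles using (Setoid)
open import Relation.Binary.PropositionalEquality
  using (_≡_; _≢_; refl; sym; trans; cong; cong₂; subst; module ≡-Reasoning)

module Arithmetic where

  open import Data.Nat
  open import Data.Nat.Properties
  open import Data.Nat.DivMod
  open import Data.Nat.Combinatorics
    using (nCk≡n!/k![n-k]!; k![n∸k]!∣n!; k>n⇒nCk≡0; nCk+nC[k+1]≡[n+1]C[k+1])
  open import Data.Nat.Primality.Factorisation
    using (factorise; PrimeFactorisation; factorisationHasAllPrimeFactors)
  open import Data.Nat.Solver using (module +-*-Solver)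
  open import Data.Fin as Fin using (Fin; toℕ)
  import Data.Fin.Properties as Fin
  open import Data.Vec.Functional using (Vector; init; tail)
  import Algebra.Properties.Monoid.Sum as MonoidSum
  import Algebra.Properties.CommutativeSemiring.Binomial +-*-commutativeSemiring as Binomial
  import Algebra.Properties.Semiring.Exp +-*-semiring as Exp
  import Algebra.Properties.Semiring.Mult +-*-semiring as Mult
  open +-*-Solver using (solve; _:=_; _:+_; _:*_; con)

  -- Binomial coefficients modulo a prime and the theorem of Lucas.

  nCk*k![n∸k]!≡n! : ∀ {n k} → k ≤ n → (n C k) * (k ! * (n ∸ k) !) ≡ n !
  nCk*k![n∸k]!≡n! {n} {k} k≤n =
    trans (cong (_* (k ! * (n ∸ k) !)) (nCk≡n!/k![n-k]! k≤n)) (m/n*n≡m (k![n∸k]!∣n! k≤n))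
    where instance _ = k !* (n ∸ k) !≢0

  p∤n! : ∀ {p} → Prime p → ∀ n → n < p → ¬ p ∣ n !
  p∤n! {p} pr zero    n<p p∣1 = ¬prime[1] (subst Prime (∣1⇒≡1 p∣1) pr)
  p∤n! {p} pr (suc n) n<p p∣  with euclidsLemma (suc n) (n !) pr p∣
  ... | inj₁ p∣n  = >⇒∤ n<p p∣n
  ... | inj₂ p∣n! = p∤n! pr n (<-trans (n<1+n n) n<p) p∣n!

  p∣pCk : ∀ {p} → Prime p → ∀ {k} → 0 < k → k < p → p ∣ p C k
  p∣pCk {p@(suc q)} pr {k} 0<k k<p
    with euclidsLemma (p C k) (k ! * (p ∸ k) !) pr (subst (p ∣_) (sym (nCk*k![n∸k]!≡n! (<⇒≤ k<p))) (m∣m*n (q !)))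
  ... | inj₁ p∣C = p∣C
  ... | inj₂ p∣k!l! with euclidsLemma (k !) ((p ∸ k) !) pr p∣k!l!
  ...   | inj₁ p∣k! = contradiction p∣k! (p∤n! pr k k<p)
  ...   | inj₂ p∣l! = contradiction p∣l! (p∤n! pr (p ∸ k) (∸-monoʳ-< 0<k (<⇒≤ k<p)))
  p∣pCk {zero} pr = contradiction pr ¬prime[0]

  p∤nCk : ∀ {p} → Prime p → ∀ {n k} → n < p → k ≤ n → ¬ p ∣ n C k
  p∤nCk pr {n} {k} n<p k≤n p∣C =
    p∤n! pr n n<p (subst (_ ∣_) (nCk*k![n∸k]!≡n! k≤n) (∣m⇒∣m*n (k ! * (n ∸ k) !) p∣C))

  module Modular (p : ℕ) .{{_ : NonZero p}} where

    infix 4 _≈_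
    -- A record instead of the bare equation, so that both numbers can be inferred from the type of
    -- a congruence.
    record _≈_ (m n : ℕ) : Set where
      constructor mod-≡
      field %-≡ : m % p ≡ n % p
    open _≈_ public

    ≈-setoid : Setoid 0ℓ 0ℓ
    ≈-setoid = record
      { _≈_ = _≈_
      ; isEquivalence = record
        { refl  = mod-≡ refl
        ; sym   = λ e → mod-≡ (sym (%-≡ e))
        ; trans = λ e f → mod-≡ (trans (%-≡ e) (%-≡ f)) } }
    open Setoid ≈-setoid public using ()
      renaming (refl to ≈-refl; sym to ≈-sym; trans to ≈-trans; reflexive to ≡⇒≈)

    +-cong : ∀ {a b c d} → a ≈ b → c ≈ d → a + c ≈ b + d
    +-cong {a} {b} {c} {d} (mod-≡ e) (mod-≡ f) = mod-≡
      (trans (%-distribˡ-+ a c p) (trans (cong₂ (λ x y → (x + y) % p) e f) (sym (%-distribˡ-+ b d p))))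

    *-cong : ∀ {a b c d} → a ≈ b → c ≈ d → a * c ≈ b * d
    *-cong {a} {b} {c} {d} (mod-≡ e) (mod-≡ f) = mod-≡
      (trans (%-distribˡ-* a c p) (trans (cong₂ (λ x y → (x * y) % p) e f) (sym (%-distribˡ-* b d p))))

    ∣⇒≈0 : ∀ {n} → p ∣ n → n ≈ 0
    ∣⇒≈0 {n} p∣n = mod-≡ (trans (n∣m⇒m%n≡0 n p p∣n) (sym (n∣m⇒m%n≡0 0 p (p ∣0))))

    ∣-resp-≈ : ∀ {m n} → m ≈ n → p ∣ m → p ∣ n
    ∣-resp-≈ {m} {n} (mod-≡ e) p∣m = m%n≡0⇒n∣m n p (trans (sym e) (n∣m⇒m%n≡0 m p p∣m))

  module Lucas (q : ℕ) (pr : Prime (suc q)) where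
    private p = suc q
    open Modular p
    open SetoidReasoning ≈-setoid

    private
      pascal : ∀ n k → suc n C suc k ≡ n C k + n C suc k
      pascal n k = sym (nCk+nC[k+1]≡[n+1]C[k+1] n k)

      borrow : ∀ k → suc k * p + 0 ≡ suc (k * p + q)
      borrow k = trans (+-identityʳ _) (cong suc (+-comm q (k * p)))

    -- Pascal's rule lowers the upper argument by one. Within a block (last digit `suc a`) it acts
    -- on the last digits alone, or borrows a column `q` in which `a C q` = 0. At the start of a
    -- block the predecessor ends in `q`: then `q C b + q C suc b` is `p C suc b`, which vanishes
    -- modulo p, or `q C q` = 1 lets Pascal's rule act on the leading parts.
    lucas : ∀ n a → a < p → ∀ k b → b < p → (n * p + a) C (k * p + b) ≈ (n C k) * (a C b)
    lucas zero zero a<p zero zero b<p = ≈-refl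
    lucas zero zero a<p zero (suc b) b<p = ≈-refl
    lucas zero zero a<p (suc k) b b<p = ≈-refl
    lucas n (suc a) a<p zero zero b<p = ≈-refl
    lucas n (suc a) a<p k (suc b) b<p = begin
      (n * p + suc a) C (k * p + suc b)           ≡⟨ cong₂ _C_ (+-suc (n * p) a) (+-suc (k * p) b) ⟩
      suc (n * p + a) C suc (k * p + b)           ≡⟨ pascal (n * p + a) (k * p + b) ⟩
      (n * p + a) C (k * p + b) + (n * p + a) C suc (k * p + b)
        ≡⟨ cong (λ z → (n * p + a) C (k * p + b) + (n * p + a) C z) (+-suc (k * p) b) ⟨
      (n * p + a) C (k * p + b) + (n * p + a) C (k * p + suc b)
        ≈⟨ +-cong (lucas n a (<⇒≤ a<p) k b (<⇒≤ b<p)) (lucas n a (<⇒≤ a<p) k (suc b) b<p) ⟩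
      (n C k) * (a C b) + (n C k) * (a C suc b)   ≡⟨ *-distribˡ-+ (n C k) (a C b) (a C suc b) ⟨
      (n C k) * (a C b + a C suc b)               ≡⟨ cong ((n C k) *_) (pascal a b) ⟨
      (n C k) * (suc a C suc b)                   ∎
    lucas n (suc a) a<p (suc k) zero b<p = begin
      (n * p + suc a) C (suc k * p + 0)           ≡⟨ cong₂ _C_ (+-suc (n * p) a) (borrow k) ⟩
      suc (n * p + a) C suc (k * p + q)           ≡⟨ pascal (n * p + a) (k * p + q) ⟩
      (n * p + a) C (k * p + q) + (n * p + a) C suc (k * p + q)
        ≡⟨ cong (λ z → (n * p + a) C (k * p + q) + (n * p + a) C z) (borrow k) ⟨
      (n * p + a) C (k * p + q) + (n * p + a) C (suc k * p + 0)
        ≈⟨ +-cong (lucas n a (<⇒≤ a<p) k q (n<1+n q)) (lucas n a (<⇒≤ a<p) (suc k) 0 b<p) ⟩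
      (n C k) * (a C q) + (n C suc k) * 1
        ≡⟨ cong (λ z → (n C k) * z + (n C suc k) * 1) (k>n⇒nCk≡0 (≤-pred a<p)) ⟩
      (n C k) * 0 + (n C suc k) * 1               ≡⟨ cong (_+ (n C suc k) * 1) (*-zeroʳ (n C k)) ⟩
      (n C suc k) * 1                             ∎
    lucas (suc n) zero a<p zero zero b<p = ≈-refl
    lucas (suc n) zero a<p k (suc b) b<p = begin
      (suc n * p + 0) C (k * p + suc b)           ≡⟨ cong₂ _C_ (borrow n) (+-suc (k * p) b) ⟩
      suc (n * p + q) C suc (k * p + b)           ≡⟨ pascal (n * p + q) (k * p + b) ⟩
      (n * p + q) C (k * p + b) + (n * p + q) C suc (k * p + b)
        ≡⟨ cong (λ z → (n * p + q) C (k * p + b) + (n * p + q) C z) (+-suc (k * p) b) ⟨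
      (n * p + q) C (k * p + b) + (n * p + q) C (k * p + suc b)
        ≈⟨ +-cong (lucas n q (n<1+n q) k b (<⇒≤ b<p)) (lucas n q (n<1+n q) k (suc b) b<p) ⟩
      (n C k) * (q C b) + (n C k) * (q C suc b)   ≡⟨ *-distribˡ-+ (n C k) (q C b) (q C suc b) ⟨
      (n C k) * (q C b + q C suc b)               ≡⟨ cong ((n C k) *_) (pascal q b) ⟨
      (n C k) * (p C suc b)                       ≈⟨ ∣⇒≈0 (∣n⇒∣m*n (n C k) (p∣pCk pr (s≤s z≤n) b<p)) ⟩
      0                                           ≡⟨ *-zeroʳ (suc n C k) ⟨
      (suc n C k) * (0 C suc b)                   ∎
    lucas (suc n) zero a<p (suc k) zero b<p = begin
      (suc n * p + 0) C (suc k * p + 0)           ≡⟨ cong₂ _C_ (borrow n) (borrow k) ⟩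
      suc (n * p + q) C suc (k * p + q)           ≡⟨ pascal (n * p + q) (k * p + q) ⟩
      (n * p + q) C (k * p + q) + (n * p + q) C suc (k * p + q)
        ≡⟨ cong (λ z → (n * p + q) C (k * p + q) + (n * p + q) C z) (borrow k) ⟨
      (n * p + q) C (k * p + q) + (n * p + q) C (suc k * p + 0)
        ≈⟨ +-cong (lucas n q (n<1+n q) k q (n<1+n q)) (lucas n q (n<1+n q) (suc k) 0 b<p) ⟩
      (n C k) * (q C q) + (n C suc k) * 1         ≡⟨ cong (λ z → (n C k) * z + (n C suc k) * 1) (nCn≡1 q) ⟩
      (n C k) * 1 + (n C suc k) * 1               ≡⟨ *-distribʳ-+ 1 (n C k) (n C suc k) ⟨
      (n C k + n C suc k) * 1                     ≡⟨ cong (_* 1) (pascal n k) ⟨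
      (suc n C suc k) * 1                         ∎

  prime-∤-* : ∀ {p m n} → Prime p → ¬ p ∣ m → ¬ p ∣ n → ¬ p ∣ m * n
  prime-∤-* {m = m} {n} pr p∤m p∤n p∣mn = [ p∤m , p∤n ]′ (euclidsLemma m n pr p∣mn)

  -- Base-p digit sums.

  module Digits (q : ℕ) where
    private p = suc (suc q)

    fuelled : ℕ → ℕ → ℕ
    fuelled zero    m = 0
    fuelled (suc f) m = m % p + fuelled f (m / p)

    -- The local function of digitSum cannot be named here; the underscore in
    -- go≡fuelled is solved to it by its use in digitSum≡fuelled, once its
    -- arguments have been abstracted to distinct variables.
    mutual
      digitSum≡fuelled : ∀ n → digitSum p n ≡ fuelled n n
      digitSum≡fuelled zero = refl
      digitSum≡fuelled (suc f) with suc f / p | suc f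
      ... | m | n = cong (_ +_) (go≡fuelled n f m)

      go≡fuelled : ∀ n f m → _ ≡ fuelled f m
      go≡fuelled n zero    m = refl
      go≡fuelled n (suc f) m = cong (m % p +_) (go≡fuelled n f (m / p))

    m*p+a/p : ∀ m a → a < p → (m * p + a) / p ≡ m
    m*p+a/p m a a<p = begin
      (m * p + a) / p     ≡⟨ +-distrib-/-∣ˡ a (n∣m*n m) ⟩
      m * p / p + a / p   ≡⟨ cong₂ _+_ (m*n/n≡m m p) (m<n⇒m/n≡0 a<p) ⟩
      m + 0               ≡⟨ +-identityʳ m ⟩
      m                   ∎
      where open ≡-Reasoning

    m*p+a%p : ∀ m a → a < p → (m * p + a) % p ≡ a
    m*p+a%p m a a<p = trans (cong (_% p) (+-comm (m * p) a)) (trans ([m+kn]%n≡m%n a m p) (m<n⇒m%n≡m a<p))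

    /p≤ : ∀ m f → m ≤ suc f → m / p ≤ f
    /p≤ zero    f m≤f = z≤n
    /p≤ (suc m) f m≤f = ≤-pred (≤-trans (m/n<m (suc m) p (s≤s (s≤s z≤n))) m≤f)

    fuelled-enough : ∀ f g m → m ≤ f → m ≤ g → fuelled f m ≡ fuelled g m
    fuelled-enough zero    zero    m m≤f m≤g = refl
    fuelled-enough zero    (suc g) zero m≤f m≤g = fuelled-enough zero g zero z≤n z≤n
    fuelled-enough (suc f) zero    zero m≤f m≤g = fuelled-enough f zero zero z≤n z≤n
    fuelled-enough (suc f) (suc g) m m≤f m≤g =
      cong (m % p +_) (fuelled-enough f g (m / p) (/p≤ m f m≤f) (/p≤ m g m≤g))

    digitSum-step : ∀ m a → a < p → digitSum p (m * p + a) ≡ a + digitSum p m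
    digitSum-step m a a<p = begin
      digitSum p n          ≡⟨ digitSum≡fuelled n ⟩
      -- One surplus unit of fuel lets the last digit unfold without a case distinction on `n`.
      fuelled n n           ≡⟨ fuelled-enough n (suc n) n ≤-refl (n≤1+n n) ⟩
      n % p + fuelled n (n / p) ≡⟨ cong₂ (λ x y → x + fuelled n y) (m*p+a%p m a a<p) (m*p+a/p m a a<p) ⟩
      a + fuelled n m       ≡⟨ cong (a +_) (fuelled-enough n m m m≤n ≤-refl) ⟩
      a + fuelled m m       ≡⟨ cong (a +_) (digitSum≡fuelled m) ⟨
      a + digitSum p m      ∎
      where
      open ≡-Reasoning
      n = m * p + a
      m≤n : m ≤ n
      m≤n = ≤-trans (m≤m*n m p) (m≤m+n (m * p) a)

    n≡[n/p]*p+n%p : ∀ n → n ≡ (n / p) * p + n % p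
    n≡[n/p]*p+n%p n = trans (m≡m%n+[m/n]*n n p) (+-comm (n % p) _)

    digit-induction : (P : ℕ → Set) → P 0 → (∀ m a → a < p → P m → P (m * p + a)) → ∀ n → P n
    digit-induction P P0 step = <-rec P rec
      where
      rec : ∀ n → (∀ {m} → m < n → P m) → P n
      rec zero    ih = P0
      rec (suc n) ih = subst P (sym (n≡[n/p]*p+n%p (suc n)))
        (step _ _ (m%n<n (suc n) p) (ih (m/n<m (suc n) p (s≤s (s≤s z≤n)))))

    digitSum≤ : ∀ n → digitSum p n ≤ n
    digitSum≤ = digit-induction _ z≤n λ m a a<p ih → begin
      digitSum p (m * p + a) ≡⟨ digitSum-step m a a<p ⟩
      a + digitSum p m       ≤⟨ +-monoʳ-≤ a (≤-trans ih (m≤m*n m p)) ⟩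
      a + m * p              ≡⟨ +-comm a (m * p) ⟩
      m * p + a              ∎
      where open ≤-Reasoning

    digitSum≡0⇒≡0 : ∀ n → digitSum p n ≡ 0 → n ≡ 0
    digitSum≡0⇒≡0 = digit-induction _ (λ _ → refl) λ m a a<p ih s≡0 →
      let a+s≡0 = trans (sym (digitSum-step m a a<p)) s≡0
      in cong₂ (λ x y → x * p + y) (ih (m+n≡0⇒n≡0 a a+s≡0)) (m+n≡0⇒m≡0 a a+s≡0)

    -- As p = 1 + (p - 1), dropping the weight of the leading part turns `m * p + a` into `a + m` up
    -- to `m * (p − 1)`.
    casting-out : ∀ n → ∃[ j ] n ≡ digitSum p n + j * suc q
    casting-out = digit-induction _ (0 , refl) λ { m a a<p (j , m≡) → j + m , (begin
      m * p + a
        ≡⟨ solve 3 (λ m a q → m :* (con 2 :+ q) :+ a := a :+ m :+ m :* (con 1 :+ q)) refl m a q ⟩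
      a + m + m * suc q
        ≡⟨ cong (λ z → a + z + m * suc q) m≡ ⟩
      a + (digitSum p m + j * suc q) + m * suc q
        ≡⟨ solve 5 (λ a s j m r → a :+ (s :+ j :* r) :+ m :* r := a :+ s :+ (j :+ m) :* r) refl a _ j m (suc q) ⟩
      a + digitSum p m + (j + m) * suc q
        ≡⟨ cong (_+ (j + m) * suc q) (digitSum-step m a a<p) ⟨
      digitSum p (m * p + a) + (j + m) * suc q ∎) }
      where open ≡-Reasoning

    -- The source of the bounds on p: the digit sum of `m * p + a` is `a` plus that of `m`, hence at
    -- most `a + m`. For m = 0 it would be the single digit a < p.
    p≤digitSum⇒p≤quotient+remainder : ∀ n → p ≤ digitSum p n → ∃[ m ] ∃[ a ] (a < p × 1 ≤ m × p ≤ m + a × n ≡ m * p + a)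
    p≤digitSum⇒p≤quotient+remainder n p≤s with n / p | n % p | m%n<n n p | n≡[n/p]*p+n%p n
    ... | zero  | a | a<p | refl =
      contradiction (subst (p ≤_) (trans (digitSum-step 0 a a<p) (+-identityʳ a)) p≤s) (<⇒≱ a<p)
    ... | suc m | a | a<p | refl = suc m , a , a<p , s≤s z≤n ,
      ≤-trans p≤s (≤-trans (≤-reflexive (trans (digitSum-step (suc m) a a<p) (+-comm a _)))
        (+-monoˡ-≤ a (digitSum≤ (suc m)))) , refl

    module _ (pr : Prime p) where
      open Modular p
      open Lucas (suc q) pr

      lucas-∤ : ∀ n a → a < p → ∀ k b → b < p → ¬ p ∣ n C k → ¬ p ∣ a C b → ¬ p ∣ (n * p + a) C (k * p + b)
      lucas-∤ n a a<p k b b<p ∤₁ ∤₂ p∣ = prime-∤-* pr ∤₁ ∤₂ (∣-resp-≈ (lucas n a a<p k b b<p) p∣)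

      ∤-lucas : ∀ n a → a < p → ∀ k b → b < p → ¬ p ∣ (n * p + a) C (k * p + b) → ¬ p ∣ n C k × ¬ p ∣ a C b
      ∤-lucas n a a<p k b b<p ∤ =
        (λ p∣ → ∤ (∣-resp-≈ (≈-sym (lucas n a a<p k b b<p)) (∣m⇒∣m*n (a C b) p∣))) ,
        (λ p∣ → ∤ (∣-resp-≈ (≈-sym (lucas n a a<p k b b<p)) (∣n⇒∣m*n (n C k) p∣)))

      ∤⇒≤ : ∀ {n k} → ¬ p ∣ n C k → k ≤ n
      ∤⇒≤ {n} {k} ∤ with k ≤? n
      ... | yes k≤n = k≤n
      ... | no  k≰n = contradiction (subst (p ∣_) (sym (k>n⇒nCk≡0 (≰⇒> k≰n))) (p ∣0)) ∤

      -- A greedy choice from the lowest digit: either `t` fits into the digit `a`, or `a` is taken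
      -- whole and `t ∸ a` is left to the higher digits. The digits of `k` never exceed those of
      -- `n`, so Lucas applies.
      ∃-subsum : ∀ n t → t ≤ digitSum p n → ∃[ k ] (digitSum p k ≡ t × ¬ p ∣ n C k)
      ∃-subsum = digit-induction _ base step
        where
        base : ∀ t → t ≤ 0 → ∃[ k ] (digitSum p k ≡ t × ¬ p ∣ 0 C k)
        base zero t≤0 = 0 , refl , p∤nCk pr {0} {0} (s≤s z≤n) z≤n
        step : ∀ m a → a < p → (∀ t → t ≤ digitSum p m → ∃[ k ] (digitSum p k ≡ t × ¬ p ∣ m C k)) →
               ∀ t → t ≤ digitSum p (m * p + a) → ∃[ k ] (digitSum p k ≡ t × ¬ p ∣ (m * p + a) C k)
        step m a a<p ih t t≤ with ≤-total t a
        ... | inj₁ t≤a = 0 * p + t , trans (digitSum-step 0 t t<p) (+-identityʳ t) ,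
            lucas-∤ m a a<p 0 t t<p (λ p∣1 → p∤nCk pr {0} {0} (s≤s z≤n) z≤n p∣1) (p∤nCk pr a<p t≤a)
          where t<p = ≤-<-trans t≤a a<p
        ... | inj₂ a≤t with ih (t ∸ a) (≤-trans (∸-monoˡ-≤ a (≤-trans t≤ (≤-reflexive (digitSum-step m a a<p))))
                                         (≤-reflexive (m+n∸m≡n a _)))
        ...   | k , s≡ , p∤ = k * p + a ,
                trans (digitSum-step k a a<p) (trans (cong (a +_) s≡) (m+[n∸m]≡n a≤t)) ,
                lucas-∤ m a a<p k a a<p p∤ (p∤nCk pr a<p ≤-refl)

      -- By Lucas each digit of `k` is at most the corresponding digit of `n`, and equal sums force
      -- equality digit by digit. The second half makes the inequality strict for k ≠ n.
      digitSum-sub : ∀ n k → ¬ p ∣ n C k → digitSum p k ≤ digitSum p n × (digitSum p k ≡ digitSum p n → k ≡ n)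
      digitSum-sub = digit-induction _ base step
        where
        R : ℕ → ℕ → Set
        R n k = ¬ p ∣ n C k → digitSum p k ≤ digitSum p n × (digitSum p k ≡ digitSum p n → k ≡ n)
        Q : ℕ → Set
        Q n = ∀ k → R n k
        base : Q 0
        base zero    ∤ = z≤n , λ _ → refl
        base (suc k) ∤ = contradiction (∤⇒≤ {0} {suc k} ∤) λ ()
        step′ : ∀ m a → a < p → Q m → ∀ l b → b < p → R (m * p + a) (l * p + b)
        step′ m a a<p ih l b b<p ∤ rewrite digitSum-step m a a<p | digitSum-step l b b<p
          with ∤-lucas m a a<p l b b<p ∤
        ... | ∤₁ , ∤₂ with ∤⇒≤ ∤₂ | ih l ∤₁
        ...   | b≤a | s≤ , s≡⇒ = +-mono-≤ b≤a s≤ , eq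
          where
          eq : b + digitSum p l ≡ a + digitSum p m → l * p + b ≡ m * p + a
          eq e with m≤n⇒m<n∨m≡n b≤a
          ... | inj₁ b<a = contradiction e (<⇒≢ (+-mono-<-≤ b<a s≤))
          ... | inj₂ refl = cong (λ z → z * p + b) (s≡⇒ (+-cancelˡ-≡ b _ _ e))
        step : ∀ m a → a < p → Q m → Q (m * p + a)
        step m a a<p ih k = subst (R (m * p + a)) (sym (n≡[n/p]*p+n%p k)) (step′ m a a<p ih (k / p) (k % p) (m%n<n k p))

      -- The digit sum of `k` is chosen as p - 1: it is positive, so k ≠ 0; it is below that of `n`,
      -- so k ≠ n; and casting out carries p - 1 over to a divisor of `k`.
      p≤digitSum⇒∃ : ∀ n → p ≤ digitSum p n → ∃[ k ] (0 < k × k < n × suc q ∣ k × ¬ p ∣ n C k)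
      p≤digitSum⇒∃ n p≤s with ∃-subsum n (suc q) (<⇒≤ p≤s)
      ... | k , s≡ , ∤ = k , n≢0⇒n>0 k≢0 , ≤∧≢⇒< (∤⇒≤ ∤) k≢n , [p-1]∣k , ∤
        where
        k≢0 : k ≢ 0
        k≢0 refl = contradiction s≡ λ ()
        k≢n : k ≢ n
        k≢n refl = <⇒≢ p≤s (sym s≡)
        [p-1]∣k : suc q ∣ k
        [p-1]∣k with casting-out k
        ... | j , k≡ = divides (suc j) (trans k≡ (cong (_+ j * suc q) s≡))

      -- The digit sum of `k` is a positive multiple of p - 1, hence at least p - 1, and that of `n`
      -- is strictly larger.
      ∃⇒p≤digitSum : ∀ n k → 0 < k → k < n → suc q ∣ k → ¬ p ∣ n C k → p ≤ digitSum p n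
      ∃⇒p≤digitSum n k 0<k k<n [p-1]∣k ∤ = ≤-<-trans p-1≤s (≤∧≢⇒< s≤ (λ e → <⇒≢ k<n (s≡⇒ e)))
        where
        s≤  = proj₁ (digitSum-sub n k ∤)
        s≡⇒ = proj₂ (digitSum-sub n k ∤)
        p-1∣s : suc q ∣ digitSum p k
        p-1∣s with casting-out k
        ... | j , k≡ = ∣m+n∣m⇒∣n (subst (suc q ∣_) (trans k≡ (+-comm (digitSum p k) _)) [p-1]∣k) (n∣m*n j)
        p-1≤s : suc q ≤ digitSum p k
        p-1≤s = ∣⇒≤ {{≢-nonZero (λ s≡0 → <⇒≢ 0<k (sym (digitSum≡0⇒≡0 k s≡0)))}} p-1∣s

  -- Fermat's little theorem and power sums modulo p.

  module Hℕ = Hurwitz +-*-commutativeSemiring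

  E≡^ : ∀ a n → Hℕ.E a n ≡ a ^ n
  E≡^ a zero    = refl
  E≡^ a (suc n) = cong (a *_) (E≡^ a n)

  ι≡ : ∀ n → Hℕ.ι n ≡ n
  ι≡ zero    = refl
  ι≡ (suc n) = cong suc (ι≡ n)

  E-ι≡^ : ∀ a n → Hℕ.E (Hℕ.ι a) n ≡ a ^ n
  E-ι≡^ a n = trans (cong (λ z → Hℕ.E z n) (ι≡ a)) (E≡^ a n)

  module PowerSums (q : ℕ) (pr : Prime (suc (suc q))) where
    private p = suc (suc q)
    open Modular p
    open Hℕ using (E; ι; powerSum; _⋆_; δ; X)
    module ΣFin = MonoidSum +-0-monoid

    exp≡^ : ∀ a n → a Exp.^ n ≡ a ^ n
    exp≡^ a zero    = refl
    exp≡^ a (suc n) = cong (a *_) (exp≡^ a n)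

    ∣-× : ∀ {m} x → p ∣ m → p ∣ m Mult.× x
    ∣-× {m} x p∣m = subst (p ∣_) (sym (×≡* m)) (∣m⇒∣m*n x p∣m)
      where
      ×≡* : ∀ m → m Mult.× x ≡ m * x
      ×≡* zero    = refl
      ×≡* (suc m) = cong (x +_) (×≡* m)

    ∣-sum : ∀ {n} (t : Vector ℕ n) → (∀ i → p ∣ t i) → p ∣ ΣFin.sum t
    ∣-sum {zero}  t p∣t = p ∣0
    ∣-sum {suc n} t p∣t = ∣m∣n⇒∣m+n (p∣t Fin.zero) (∣-sum (t ∘ Fin.suc) (p∣t ∘ Fin.suc))

    freshman : ∀ (a : ℕ) → (suc a) ^ p ≈ suc (a ^ p)
    freshman a = begin
      (suc a) ^ p
        ≡⟨ cong (_^ p) (+-comm 1 a) ⟩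
      (a + 1) ^ p
        ≡⟨ exp≡^ (a + 1) p ⟨
      (a + 1) Exp.^ p
        ≡⟨ Binomial.theorem p a 1 ⟩
      t Fin.zero + ΣFin.sum (tail t)
        ≡⟨ cong (t Fin.zero +_) (ΣFin.sum-init-last (tail t)) ⟩
      t Fin.zero + (ΣFin.sum (init (tail t)) + t (Fin.fromℕ p))
        ≈⟨ +-cong (≡⇒≈ t₀) (+-cong (∣⇒≈0 (∣-sum _ p∣t)) (≡⇒≈ tₚ)) ⟩
      suc (a ^ p) ∎
      where
      open SetoidReasoning ≈-setoid
      t = Binomial.binomialTerm a 1 p
      1^≡1 : ∀ n → 1 Exp.^ n ≡ 1
      1^≡1 n = trans (exp≡^ 1 n) (^-zeroˡ n)
      t₀ : t Fin.zero ≡ 1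
      t₀ = trans (+-identityʳ _) (trans (+-identityʳ _) (1^≡1 p))
      p∣t : ∀ i → p ∣ init (tail t) i
      p∣t i = ∣-× _ (p∣pCk pr (s≤s z≤n)
        (s≤s (≤-trans (≤-reflexive (cong suc (Fin.toℕ-inject₁ i))) (Fin.toℕ<n i))))
      tₚ : t (Fin.fromℕ p) ≡ a ^ p
      tₚ rewrite Fin.toℕ-fromℕ q | nCn≡1 p | n∸n≡0 q =
        trans (+-identityʳ _) (trans (*-identityʳ _) (exp≡^ a p))

    fermat : ∀ (a : ℕ) → a ^ p ≈ a
    fermat zero    = ≈-refl
    fermat (suc a) = ≈-trans (freshman a) (+-cong {1} {1} ≈-refl (fermat a))

    -- This includes m < n, where the truncated difference is 0.
    ≈⇒∣∸ : ∀ {m n} → m ≈ n → p ∣ m ∸ n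
    ≈⇒∣∸ {m} {n} (mod-≡ e) = divides (m / p ∸ n / p) (begin
      m ∸ n                                       ≡⟨ cong₂ _∸_ (m≡m%n+[m/n]*n m p) (m≡m%n+[m/n]*n n p) ⟩
      (m % p + m / p * p) ∸ (n % p + n / p * p)   ≡⟨ cong (λ z → (z + m / p * p) ∸ (n % p + n / p * p)) e ⟩
      (n % p + m / p * p) ∸ (n % p + n / p * p)   ≡⟨ [m+n]∸[m+o]≡n∸o (n % p) _ _ ⟩
      m / p * p ∸ n / p * p                       ≡⟨ *-distribʳ-∸ p (m / p) (n / p) ⟨
      (m / p ∸ n / p) * p                         ∎)
      where open ≡-Reasoning

    fermat′ : ∀ a → 0 < a → a < p → a ^ suc q ≈ 1
    fermat′ a 0<a a<p = [ (λ p∣a → contradiction p∣a (>⇒∤ {{>-nonZero 0<a}} a<p)) , conclude ]′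
      (euclidsLemma a (a ^ suc q ∸ 1) pr p∣a[x-1])
      where
      p∣a[x-1] : p ∣ a * (a ^ suc q ∸ 1)
      p∣a[x-1] = subst (p ∣_) 
        (sym (trans (*-distribˡ-∸ a (a ^ suc q) 1) (cong (a ^ p ∸_) (*-identityʳ a)))) (≈⇒∣∸ (fermat a))
      conclude : p ∣ a ^ suc q ∸ 1 → a ^ suc q ≈ 1
      conclude p∣ = ≈-trans (≡⇒≈ (sym (m∸n+n≡m (m^n>0 a {{>-nonZero 0<a}} (suc q))))) (+-cong (∣⇒≈0 p∣) ≈-refl)

    S : ℕ → ℕ
    S = powerSum p

    -- The coefficient of t^{n+1} in (e^t − 1) Σ_{a<p} e^{at} = e^{pt} − 1 gives
    -- (n+1) S_n ≡ 0 (mod p) once the lower power sums are known to vanish.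
    S-low : ∀ n → n < suc q → p ∣ S n
    S-low = <-rec _ λ n ih n<p-1 →
      let J⋆S  = Hℕ.J⋆powerSum J J+δ p (suc n)
          p∣J⋆S : p ∣ (J ⋆ S) (suc n)
          p∣J⋆S = subst (p ∣_) (trans (sym J⋆S) (+-identityʳ _)) (subst (p ∣_) (sym (E-ι≡^ p (suc n))) (m∣m*n (p ^ n)))
          J≡ = Hℕ.⋆-distribʳ X K S (suc n)
          p∣K⋆S : p ∣ (K ⋆ S) (suc n)
          p∣K⋆S = subst (p ∣_) (Hℕ.⋆-comm S K (suc n))
            (I.⋆-closed₂ S K (suc n) refl refl (λ k k<n → ih (≤-pred k<n) (<-trans (≤-pred k<n) n<p-1)) (λ _ → tt))
          p∣nS : p ∣ suc n * S n
          p∣nS = subst (p ∣_) (trans (Hℕ.X⋆-suc S n) (cong (_* S n) (ι≡ (suc n))))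
            (∣m+n∣m⇒∣n (subst (p ∣_)
              (trans (Hℕ.⋆-cong J≡X+K (λ _ → refl) (suc n)) (trans J≡ (+-comm ((X ⋆ S) (suc n)) _))) p∣J⋆S) p∣K⋆S)
      in [ (λ p∣n → contradiction p∣n (>⇒∤ (s≤s n<p-1))) , (λ x → x) ]′ (euclidsLemma (suc n) (S n) pr p∣nS)
      where
      -- `J` is e^t - 1 and `K` is e^t - 1 - t. As `K` has order 2, coefficient n + 1 of `K ⋆ S`
      -- involves only S_k with k < n.
      J K : ℕ → ℕ
      J zero    = 0
      J (suc n) = 1
      K zero          = 0
      K (suc zero)    = 0
      K (suc (suc n)) = 1
      J+δ : ∀ n → J n + δ n ≡ E 1 n
      J+δ zero    = refl
      J+δ (suc n) = sym (trans (E≡^ 1 (suc n)) (^-zeroˡ (suc n)))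
      J≡X+K : ∀ n → J n ≡ X n + K n
      J≡X+K zero          = refl
      J≡X+K (suc zero)    = refl
      J≡X+K (suc (suc n)) = refl
      module I = Hℕ.Ideal {p ∣_} {λ _ → ⊤} {p ∣_} (subst (p ∣_)) (p ∣0) ∣m∣n⇒∣m+n (λ {x} {y} p∣x _ → ∣m⇒∣m*n y p∣x)

    -- Fermat's N^p ≡ N times N^k. The exponent has to be positive, because 0^0 = 1 breaks the
    -- period: S_0 = p ≡ 0, whereas S_{p-1} ≡ -1.
    S-periodic : ∀ N k → powerSum N (suc k + suc q) ≈ powerSum N (suc k)
    S-periodic zero    k = ≈-refl
    S-periodic (suc N) k = +-cong (S-periodic N k) (begin
      E (ι N) (suc k + suc q)  ≡⟨ E-ι≡^ N (suc k + suc q) ⟩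
      N ^ (suc k + suc q)      ≡⟨ cong (N ^_) (+-suc k (suc q)) ⟨
      N ^ (k + p)              ≡⟨ ^-distribˡ-+-* N k p ⟩
      N ^ k * N ^ p            ≈⟨ *-cong {N ^ k} ≈-refl (fermat N) ⟩
      N ^ k * N                ≡⟨ *-comm (N ^ k) N ⟩
      N ^ suc k                ≡⟨ E-ι≡^ N (suc k) ⟨
      E (ι N) (suc k)          ∎)
      where open SetoidReasoning ≈-setoid

    S-periodic* : ∀ j k → S (suc k + j * suc q) ≈ S (suc k)
    S-periodic* zero    k = ≡⇒≈ (cong S (+-identityʳ (suc k)))
    S-periodic* (suc j) k = ≈-trans
      (≡⇒≈ (cong S (trans (cong (suc k +_) (+-comm (suc q) (j * suc q))) (sym (+-assoc (suc k) (j * suc q) (suc q))))))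
      (≈-trans (S-periodic p (k + j * suc q)) (S-periodic* j k))

    -- The remainder of n modulo p - 1 is positive, so periodicity carries n down to the range of
    -- `S-low`.
    p-1∤⇒p∣S : ∀ n → ¬ suc q ∣ n → p ∣ S n
    p-1∤⇒p∣S n ∤n with n % suc q in eq | m≡m%n+[m/n]*n n (suc q) | m%n<n n (suc q)
    ... | zero  | _  | _ = contradiction (m%n≡0⇒n∣m n (suc q) eq) ∤n
    ... | suc r | n≡ | r<p-1 = subst (λ n → p ∣ S n) (sym n≡)
          (∣-resp-≈ (≈-sym (S-periodic* (n / suc q) r)) (S-low (suc r) r<p-1))

    -- By Fermat each a from 1 to N contributes 1, and a = 0 contributes 0. For N = p - 1 the value
    -- is -1 modulo p.
    S[p-1] : ∀ N → N < p → powerSum (suc N) (suc q) ≈ N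
    S[p-1] zero    N<p = ≈-refl
    S[p-1] (suc N) N<p = ≈-trans
      (+-cong (S[p-1] N (<⇒≤ N<p)) (≈-trans (≡⇒≈ (E-ι≡^ (suc N) (suc q))) (fermat′ (suc N) (s≤s z≤n) N<p)))
      (≡⇒≈ (+-comm N 1))

    p-1∣⇒p∤S : ∀ n → 0 < n → suc q ∣ n → ¬ p ∣ S n
    p-1∣⇒p∤S n 0<n (divides zero    refl) p∣S = contradiction 0<n λ ()
    p-1∣⇒p∤S n 0<n (divides (suc j) refl) p∣S =
      >⇒∤ (n<1+n (suc q)) (∣-resp-≈ (≈-trans (S-periodic* j q) (S[p-1] (suc q) (n<1+n (suc q)))) p∣S)

  -- Squarefree products of primes.

  ∃-prime-divisor : ∀ n → n ≢ 1 → ∃[ p ] (Prime p × p ∣ n)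
  ∃-prime-divisor zero n≢1 = 2 , prime[2] , (2 ∣0)
  ∃-prime-divisor n@(suc _) n≢1 with factorise n
  ... | record { factors = []; isFactorisation = n≡1 } = contradiction n≡1 n≢1
  ... | record { factors = p ∷ ps; isFactorisation = n≡; factorsPrime = pr ∷ _ } =
          p , pr , divides (product ps) (trans n≡ (*-comm p _))

  prime∣prime⇒≡ : ∀ {p q} → Prime p → Prime q → p ∣ q → p ≡ q
  prime∣prime⇒≡ pr qr p∣q = [ (λ { refl → contradiction pr ¬prime[1] }) , id ]′ (prime⇒irreducible qr p∣q)

  product-∣ : ∀ {ps e} → Unique ps → All Prime ps → (∀ {p} → p ∈ ps → p ∣ e) → product ps ∣ e
  product-∣ [] [] ∣e = 1∣ _
  product-∣ {p ∷ ps} (p∉ ∷ uniq) (pr ∷ prs) ∣e with ∣e (here refl)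
  ... | divides k refl = subst (_∣ k * p) (*-comm (product ps) p) (*-monoˡ-∣ p (product-∣ uniq prs λ {q} q∈ →
        [ id , (λ q∣p → contradiction (sym (prime∣prime⇒≡ (All.lookup prs q∈) pr q∣p)) (All.lookup p∉ q∈)) ]′
          (euclidsLemma k p (All.lookup prs q∈) (∣e (there q∈)))))

  -- If q is the head, one factor q cancels and the other divides the tail, so q recurs there
  -- against uniqueness. Otherwise the head divides the cofactor `t` and cancels from both sides.
  prime²∤product : ∀ {ps q} → Unique ps → All Prime ps → Prime q → ¬ q * q ∣ product ps
  prime²∤product {[]} [] [] qr q²∣1 = ¬prime[1] (subst Prime (∣1⇒≡1 (m*n∣⇒m∣ _ _ q²∣1)) qr)
  prime²∤product {p ∷ ps} {q} (p∉ ∷ uniq) (pr ∷ prs) qr (divides t pP≡) with q ≟ p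
  ... | yes refl = All.lookup p∉ (factorisationHasAllPrimeFactors qr q∣P prs) refl
    where
    q∣P : q ∣ product ps
    q∣P = divides t (*-cancelˡ-≡ _ _ q {{prime⇒nonZero qr}}
      (trans pP≡ (solve 2 (λ t q → t :* (q :* q) := q :* (t :* q)) refl t q)))
  ... | no q≢p with euclidsLemma t (q * q) pr (divides (product ps) (trans (sym pP≡) (*-comm p _)))
  ...   | inj₂ p∣q² = [ q≢p ∘ sym ∘ prime∣prime⇒≡ pr qr , q≢p ∘ sym ∘ prime∣prime⇒≡ pr qr ]′ (euclidsLemma q q pr p∣q²)
  ...   | inj₁ (divides s refl) = prime²∤product uniq prs qr (divides s (*-cancelˡ-≡ _ _ p {{prime⇒nonZero pr}}
          (trans pP≡ (solve 3 (λ s p x → s :* p :* x := p :* (s :* x)) refl s p (q * q)))))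

  product-squareFree : ∀ {ps} → Unique ps → All Prime ps → SquareFree (product ps)
  product-squareFree uniq prs m m²∣ with m ≟ 1
  ... | yes m≡1 = m≡1
  ... | no  m≢1 with ∃-prime-divisor m m≢1
  ...   | q , qr , q∣m = contradiction (∣-trans (*-pres-∣ q∣m q∣m) m²∣) (prime²∤product uniq prs qr)

  -- Parity, and the bounds on p implied by its digit sum.

  even⊎odd : ∀ n → 2 ∣ n ⊎ 2 ∣ suc n
  even⊎odd zero    = inj₁ (2 ∣0)
  even⊎odd (suc n) = [ (λ 2∣n → inj₂ (∣m∣n⇒∣m+n {2} {2} ∣-refl 2∣n)) , inj₁ ]′ (even⊎odd n)

  ¬even∧odd : ∀ n → 2 ∣ n → ¬ 2 ∣ suc n
  ¬even∧odd n 2∣n 2∣1+n = contradiction (∣1⇒≡1 (∣m+n∣m⇒∣n (subst (2 ∣_) (+-comm 1 n) 2∣1+n) 2∣n)) λ ()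

  digitSum-≤ : ∀ {p} → Prime p → ∀ n → digitSum p n ≤ n
  digitSum-≤ {zero}        pr = contradiction pr ¬prime[0]
  digitSum-≤ {suc zero}    pr = contradiction pr ¬prime[1]
  digitSum-≤ {suc (suc q)} pr = Digits.digitSum≤ q

  odd-prime⇒2∣p-1 : ∀ {p} → Prime p → p ≢ 2 → 2 ∣ p ∸ 1
  odd-prime⇒2∣p-1 {zero}  pr p≢2 = contradiction pr ¬prime[0]
  odd-prime⇒2∣p-1 {suc m} pr p≢2 =
    [ id , (λ 2∣p → contradiction (sym (prime∣prime⇒≡ prime[2] pr 2∣p)) p≢2) ]′ (even⊎odd m)

  -- Write n = mp + a with p ≤ m + a. For m = 1 this forces a = p - 1 and n + 1 = 2p; for m ≥ 2
  -- already n ≥ 2p.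
  p≤digitSum⇒2p≤1+n : ∀ {p} → Prime p → ∀ n → p ≤ digitSum p n → 2 * p ≤ suc n
  p≤digitSum⇒2p≤1+n {zero}     pr = contradiction pr ¬prime[0]
  p≤digitSum⇒2p≤1+n {suc zero} pr = contradiction pr ¬prime[1]
  p≤digitSum⇒2p≤1+n {p@(suc (suc q))} pr n p≤s with Digits.p≤digitSum⇒p≤quotient+remainder q n p≤s
  ... | zero , a , a<p , () , _
  ... | suc zero , a , a<p , _ , p≤1+a , refl = begin
    2 * p               ≡⟨⟩
    p + (p + 0)         ≡⟨ cong (λ x → p + x) (+-identityʳ p) ⟩
    p + p               ≤⟨ +-monoʳ-≤ p p≤1+a ⟩
    p + suc a           ≡⟨ solve 2 (λ p a → p :+ (con 1 :+ a) := con 1 :+ (con 1 :* p :+ a)) refl p a ⟩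
    suc (1 * p + a)     ∎
    where open ≤-Reasoning
  ... | suc (suc m) , a , a<p , _ , _ , refl = begin
    2 * p                     ≤⟨ m≤m+n (2 * p) (suc (m * p + a)) ⟩
    2 * p + suc (m * p + a)
      ≡⟨ solve 3 (λ p m a → con 2 :* p :+ (con 1 :+ (m :* p :+ a)) := con 1 :+ ((con 2 :+ m) :* p :+ a))
           refl p m a ⟩
    suc (suc (suc m) * p + a) ∎
    where open ≤-Reasoning

  -- Again n = mp + a with p ≤ m + a. Parity removes m = 1, where n = 2p - 1, and the case m = 2, a
  -- = p - 2, where n = 3p - 2 is odd with p. What remains is n = 3p - 1 or m ≥ 3.
  p≤digitSum⇒3p≤1+n : ∀ {p} → Prime p → p ≢ 2 → ∀ n → 2 ∣ n → p ≤ digitSum p n → 3 * p ≤ suc n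
  p≤digitSum⇒3p≤1+n {zero}     pr = contradiction pr ¬prime[0]
  p≤digitSum⇒3p≤1+n {suc zero} pr = contradiction pr ¬prime[1]
  p≤digitSum⇒3p≤1+n {p@(suc (suc q))} pr p≢2 n 2∣n p≤s with Digits.p≤digitSum⇒p≤quotient+remainder q n p≤s
  ... | zero , a , a<p , () , _
  ... | suc zero , a , a<p , _ , p≤1+a , refl = contradiction
          (subst (2 ∣_) 2p≡1+n (m∣m*n p)) (¬even∧odd (1 * p + a) 2∣n)
    where
    2p≡1+n : 2 * p ≡ suc (1 * p + a)
    2p≡1+n = trans (solve 1 (λ p → con 2 :* p := con 1 :* p :+ p) refl p)
      (trans (cong (λ x → 1 * p + x) (≤-antisym p≤1+a a<p)) (+-suc (1 * p) a))
  ... | suc (suc zero) , a , a<p , _ , p≤2+a , refl = case m≤n⇒m<n∨m≡n a<p of λ where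
      (inj₂ 1+a≡p) → ≤-reflexive (trans (solve 1 (λ p → con 3 :* p := con 2 :* p :+ p) refl p)
        (trans (cong (λ x → 2 * p + x) (sym 1+a≡p)) (+-suc (2 * p) a)))
      (inj₁ 1+a<p) → contradiction (2∣p (≤-antisym p≤2+a 1+a<p)) (p≢2 ∘ sym ∘ prime∣prime⇒≡ prime[2] pr)
    where
    2∣p : p ≡ suc (suc a) → 2 ∣ p
    2∣p p≡2+a = subst (2 ∣_) (sym p≡2+a) (∣m∣n⇒∣m+n {2} {2} ∣-refl (∣m+n∣m⇒∣n 2∣n (∣m⇒∣m*n p ∣-refl)))
  ... | suc (suc (suc m)) , a , a<p , _ , _ , refl = begin
    3 * p                     ≤⟨ m≤m+n (3 * p) (suc (m * p + a)) ⟩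
    3 * p + suc (m * p + a)
      ≡⟨ solve 3 (λ p m a → con 3 :* p :+ (con 1 :+ (m :* p :+ a)) := con 1 :+ ((con 3 :+ m) :* p :+ a))
           refl p m a ⟩
    suc (suc (suc (suc m)) * p + a) ∎
    where open ≤-Reasoning

  -- This brings the prime 2 into the product for odd n ≥ 3: the last binary digit is 1 and another
  -- one is nonzero.
  2≤digitSum₂ : ∀ k → 1 ≤ k → 2 ≤ digitSum 2 (k * 2 + 1)
  2≤digitSum₂ k 1≤k = subst (2 ≤_) (sym (Digits.digitSum-step 0 k 1 (s≤s (s≤s z≤n))))
    (s≤s (n≢0⇒n>0 λ s≡0 → <⇒≢ 1≤k (sym (Digits.digitSum≡0⇒≡0 0 k s≡0))))

  ∃-larger-prime : ∀ M → ∃[ p ] (Prime p × M < p)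
  ∃-larger-prime M =
    let p , pr , p∣1+M! = ∃-prime-divisor (suc (M !)) (λ e → ≢-nonZero⁻¹ (M !) {{M !≢0}} (suc-injective e))
        p∣1 : p ≤ M → p ∣ 1
        p∣1 p≤M = ∣m+n∣m⇒∣n (subst (p ∣_) (+-comm 1 (M !)) p∣1+M!) (p∣M! pr p≤M)
    in p , pr , ≰⇒> λ p≤M → ¬prime[1] (subst Prime (∣1⇒≡1 (p∣1 p≤M)) pr)
    where
    p∣M! : ∀ {p} → Prime p → p ≤ M → p ∣ M !
    p∣M! {zero}  pr p≤M = contradiction pr ¬prime[0]
    p∣M! {suc m} pr p≤M = ∣-trans (m∣m*n (m !)) (m≤n⇒m!∣n! p≤M)

open Arithmetic

open import Data.Nat.Coprimality using (1-coprimeTo; coprime-divisor)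
import Data.Nat.Coprimality as Coprimality
open import Data.Integer as ℤ using (ℤ; +_; -[1+_])
import Data.Integer.Properties as ℤₚ
open import Data.Rational as ℚ using (ℚ; mkℚ; ↧ₙ_; ↥_; 0ℚ; 1ℚ; _/_)
import Data.Rational.Properties as ℚₚ
import Data.Rational.Unnormalised as ℚᵘ
import Data.Rational.Solver as ℚSolver
open ℚSolver.+-*-Solver using (solve; _:=_; _:+_; _:*_; :-_; con)

-- Rational numbers, p-integrality and divisibility by p.

fromℤ : ℤ → ℚ
fromℤ z = z / 1

nat : ℕ → ℚ
nat n = + n / 1

-- For a variable `z` the quotient `z / 1` is stuck on its normalisation; the `mkℚ` form shows
-- numerator and denominator.
fromℤ≡mkℚ : ∀ z → fromℤ z ≡ mkℚ z 0 (Coprimality.sym (1-coprimeTo ℤ.∣ z ∣))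
fromℤ≡mkℚ z = ℚₚ.↥p/↧p≡p (mkℚ z 0 (Coprimality.sym (1-coprimeTo ℤ.∣ z ∣)))

fromℤ-injective : ∀ {x y} → fromℤ x ≡ fromℤ y → x ≡ y
fromℤ-injective {x} {y} e = cong ↥_ (trans (sym (fromℤ≡mkℚ x)) (trans e (fromℤ≡mkℚ y)))

fromℤ-+ : ∀ x y → fromℤ (x ℤ.+ y) ≡ fromℤ x ℚ.+ fromℤ y
fromℤ-+ x y = sym (trans (cong₂ ℚ._+_ (fromℤ≡mkℚ x) (fromℤ≡mkℚ y))
  (cong (_/ 1) (cong₂ ℤ._+_ (ℤₚ.*-identityʳ x) (ℤₚ.*-identityʳ y))))

fromℤ-* : ∀ x y → fromℤ (x ℤ.* y) ≡ fromℤ x ℚ.* fromℤ y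
fromℤ-* x y = sym (cong₂ ℚ._*_ (fromℤ≡mkℚ x) (fromℤ≡mkℚ y))

nat-+ : ∀ m n → nat (m + n) ≡ nat m ℚ.+ nat n
nat-+ m n = fromℤ-+ (+ m) (+ n)

nat-* : ∀ m n → nat (m * n) ≡ nat m ℚ.* nat n
nat-* m n = trans (cong fromℤ (ℤₚ.pos-* m n)) (fromℤ-* (+ m) (+ n))

*-denominator : ∀ q → nat (↧ₙ q) ℚ.* q ≡ fromℤ (↥ q)
*-denominator q@(mkℚ n d c) = trans (cong (ℚ._* q) (fromℤ≡mkℚ (+ suc d)))
  (ℚₚ.fromℚᵘ-cong {ℚᵘ.mkℚᵘ (+ suc d ℤ.* n) (d + 0)} {ℚᵘ.mkℚᵘ n 0}
    (ℚᵘ.*≡* (trans (ℤₚ.*-identityʳ (+ suc d ℤ.* n)) (trans (ℤₚ.*-comm (+ suc d) n)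
      (cong (λ z → n ℤ.* + suc z) (sym (ℕₚ.+-identityʳ d)))))))

-- Clearing denominators shows that the denominator divides `m` times the numerator, to which it is
-- coprime.
denominator-∣ : ∀ m q z → nat m ℚ.* q ≡ fromℤ z → ↧ₙ q ∣ m
denominator-∣ m q@(mkℚ n d c) z e = coprime-divisor (Coprimality.sym (Coprimality.recompute c)) ↧∣
  where
  m↥≡z↧ : + m ℤ.* n ≡ z ℤ.* + suc d
  m↥≡z↧ = fromℤ-injective (begin
    fromℤ (+ m ℤ.* n)                  ≡⟨ fromℤ-* (+ m) n ⟩
    nat m ℚ.* fromℤ n                  ≡⟨ cong (nat m ℚ.*_) (*-denominator q) ⟨
    nat m ℚ.* (nat (suc d) ℚ.* q)
      ≡⟨ solve 3 (λ a b x → a :* (b :* x) := a :* x :* b) refl (nat m) (nat (suc d)) q ⟩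
    nat m ℚ.* q ℚ.* nat (suc d)        ≡⟨ cong (ℚ._* nat (suc d)) e ⟩
    fromℤ z ℚ.* nat (suc d)            ≡⟨ fromℤ-* z (+ suc d) ⟨
    fromℤ (z ℤ.* + suc d)              ∎)
    where open ≡-Reasoning
  ↧∣ : suc d ∣ ℤ.∣ n ∣ * m
  ↧∣ = divides ℤ.∣ z ∣ (trans (ℕₚ.*-comm ℤ.∣ n ∣ m)
    (trans (sym (ℤₚ.abs-* (+ m) n)) (trans (cong ℤ.∣_∣ m↥≡z↧) (ℤₚ.abs-* z (+ suc d)))))

integral⇒fromℤ : ∀ {q} → IsIntegral q → q ≡ fromℤ (↥ q)
integral⇒fromℤ {q} ↧≡1 = trans (sym (ℚₚ.*-identityˡ q)) (trans (cong (λ d → nat d ℚ.* q) (sym ↧≡1)) (*-denominator q))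

-- As an exponential series this is (e^t - 1)/t.
inv : ℕ → ℚ
inv n = + 1 / suc n

/-inverse : ∀ n .{{_ : ℕ.NonZero n}} → nat n ℚ.* (+ 1 / n) ≡ 1ℚ
/-inverse (suc n) = begin
  nat (suc n) ℚ.* (+ 1 / suc n)  ≡⟨ cong₂ ℚ._*_ (fromℤ≡mkℚ (+ suc n)) (ℚₚ.↥p/↧p≡p (mkℚ (+ 1) n (1-coprimeTo (suc n)))) ⟩
  (+ suc n ℤ.* + 1) / suc (n + 0)
    ≡⟨ ℚₚ.fromℚᵘ-cong {ℚᵘ.mkℚᵘ (+ suc n ℤ.* + 1) (n + 0)} {ℚᵘ.mkℚᵘ (+ 1) 0}
         (ℚᵘ.*≡* (trans (ℤₚ.*-identityʳ _) (trans (ℤₚ.*-identityʳ _)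
           (trans (cong (λ z → + suc z) (sym (ℕₚ.+-identityʳ n))) (sym (ℤₚ.*-identityˡ _)))))) ⟩
  1ℚ ∎
  where open ≡-Reasoning

nat-cancel : ∀ n .{{_ : ℕ.NonZero n}} {x y} → nat n ℚ.* x ≡ nat n ℚ.* y → x ≡ y
nat-cancel n {x} {y} e = trans (sym (lem x)) (trans (cong ((+ 1 / n) ℚ.*_) e) (lem y))
  where
  lem : ∀ x → (+ 1 / n) ℚ.* (nat n ℚ.* x) ≡ x
  lem x = trans (solve 3 (λ a b x → a :* (b :* x) := b :* a :* x) refl (+ 1 / n) (nat n) x)
    (trans (cong (ℚ._* x) (/-inverse n)) (ℚₚ.*-identityˡ x))

PIntegral : ℕ → ℚ → Set
PIntegral p q = ∃[ m ] (¬ p ∣ m × ∃[ z ] (nat m ℚ.* q ≡ fromℤ z))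

PDivisible : ℕ → ℚ → Set
PDivisible p q = ∃[ r ] (PIntegral p r × q ≡ nat p ℚ.* r)

pIntegral⇒∤↧ : ∀ {p q} → PIntegral p q → ¬ p ∣ ↧ₙ q
pIntegral⇒∤↧ {p} {q} (m , p∤m , z , e) p∣↧ = p∤m (∣-trans p∣↧ (denominator-∣ m q z e))

module Local {p : ℕ} (pr : Prime p) where

  private instance
    p≢0 : ℕ.NonZero p
    p≢0 = prime⇒nonZero pr

  fromℤ-pIntegral : ∀ z → PIntegral p (fromℤ z)
  fromℤ-pIntegral z = 1 , (λ p∣1 → ¬prime[1] (subst Prime (∣1⇒≡1 p∣1) pr)) , z , ℚₚ.*-identityˡ (fromℤ z)

  nat-pIntegral : ∀ n → PIntegral p (nat n)
  nat-pIntegral n = fromℤ-pIntegral (+ n)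

  pIntegral-+ : ∀ {x y} → PIntegral p x → PIntegral p y → PIntegral p (x ℚ.+ y)
  pIntegral-+ {x} {y} (m , p∤m , z , e) (n , p∤n , w , f) =
    m * n , prime-∤-* pr p∤m p∤n , + n ℤ.* z ℤ.+ + m ℤ.* w , (begin
    nat (m * n) ℚ.* (x ℚ.+ y)                     ≡⟨ cong (ℚ._* (x ℚ.+ y)) (nat-* m n) ⟩
    nat m ℚ.* nat n ℚ.* (x ℚ.+ y)
      ≡⟨ solve 4 (λ m n x y → m :* n :* (x :+ y) := n :* (m :* x) :+ m :* (n :* y)) refl (nat m) (nat n) x y ⟩
    nat n ℚ.* (nat m ℚ.* x) ℚ.+ nat m ℚ.* (nat n ℚ.* y) ≡⟨ cong₂ (λ u v → nat n ℚ.* u ℚ.+ nat m ℚ.* v) e f ⟩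
    nat n ℚ.* fromℤ z ℚ.+ nat m ℚ.* fromℤ w       ≡⟨ cong₂ ℚ._+_ (fromℤ-* (+ n) z) (fromℤ-* (+ m) w) ⟨
    fromℤ (+ n ℤ.* z) ℚ.+ fromℤ (+ m ℤ.* w)       ≡⟨ fromℤ-+ (+ n ℤ.* z) (+ m ℤ.* w) ⟨
    fromℤ (+ n ℤ.* z ℤ.+ + m ℤ.* w)               ∎)
    where open ≡-Reasoning

  pIntegral-* : ∀ {x y} → PIntegral p x → PIntegral p y → PIntegral p (x ℚ.* y)
  pIntegral-* {x} {y} (m , p∤m , z , e) (n , p∤n , w , f) = m * n , prime-∤-* pr p∤m p∤n , z ℤ.* w , (begin
    nat (m * n) ℚ.* (x ℚ.* y)             ≡⟨ cong (ℚ._* (x ℚ.* y)) (nat-* m n) ⟩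
    nat m ℚ.* nat n ℚ.* (x ℚ.* y)
      ≡⟨ solve 4 (λ m n x y → m :* n :* (x :* y) := m :* x :* (n :* y)) refl (nat m) (nat n) x y ⟩
    nat m ℚ.* x ℚ.* (nat n ℚ.* y)         ≡⟨ cong₂ ℚ._*_ e f ⟩
    fromℤ z ℚ.* fromℤ w                   ≡⟨ fromℤ-* z w ⟨
    fromℤ (z ℤ.* w)                       ∎)
    where open ≡-Reasoning

  pIntegral-neg : ∀ {x} → PIntegral p x → PIntegral p (ℚ.- x)
  pIntegral-neg {x} px = subst (PIntegral p) (solve 1 (λ x → con (ℚ.- 1ℚ) :* x := :- x) refl x)
    (pIntegral-* (fromℤ-pIntegral -[1+ 0 ]) px)

  *-pIntegral : ∀ k {x} → PIntegral p (nat p ℚ.* x) → PIntegral p (nat (k * p) ℚ.* x)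
  *-pIntegral k {x} px = subst (PIntegral p)
    (trans (sym (ℚₚ.*-assoc (nat k) (nat p) x)) (cong (ℚ._* x) (sym (nat-* k p))))
    (pIntegral-* (nat-pIntegral k) px)

  pIntegral-unscale : ∀ {m x} → ¬ p ∣ m → PIntegral p (nat m ℚ.* x) → PIntegral p x
  pIntegral-unscale {m} {x} p∤m (n , p∤n , z , e) = n * m , prime-∤-* pr p∤n p∤m , z ,
    trans (cong (ℚ._* x) (nat-* n m)) (trans (ℚₚ.*-assoc (nat n) (nat m) x) e)

  pDivisible-+ : ∀ {x y} → PDivisible p x → PDivisible p y → PDivisible p (x ℚ.+ y)
  pDivisible-+ (r , pr , e) (s , ps , f) = r ℚ.+ s , pIntegral-+ pr ps ,
    trans (cong₂ ℚ._+_ e f) (sym (ℚₚ.*-distribˡ-+ (nat p) r s))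

  pDivisible-*ˡ : ∀ {x y} → PIntegral p x → PDivisible p y → PDivisible p (x ℚ.* y)
  pDivisible-*ˡ {x} px (r , pr , e) = x ℚ.* r , pIntegral-* px pr ,
    trans (cong (x ℚ.*_) e) (solve 3 (λ x p r → x :* (p :* r) := p :* (x :* r)) refl x (nat p) r)

  pDivisible-0 : PDivisible p 0ℚ
  pDivisible-0 = 0ℚ , fromℤ-pIntegral (+ 0) , sym (ℚₚ.*-zeroʳ (nat p))

  ∣⇒pDivisible : ∀ {m} → p ∣ m → PDivisible p (nat m)
  ∣⇒pDivisible (divides k refl) = nat k , nat-pIntegral k , trans (nat-* k p) (ℚₚ.*-comm (nat k) (nat p))

  pDivisible⇒∣ : ∀ {m} → PDivisible p (nat m) → p ∣ m
  pDivisible⇒∣ {m} (r , (u , p∤u , z , e) , f) = [ (λ p∣u → contradiction p∣u p∤u) , (λ x → x) ]′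
    (euclidsLemma u m pr (divides ℤ.∣ z ∣ (trans (cong ℤ.∣_∣ um≡zp) (ℤₚ.abs-* z (+ p)))))
    where
    um≡zp : + (u * m) ≡ z ℤ.* + p
    um≡zp = fromℤ-injective (begin
      nat (u * m)                 ≡⟨ nat-* u m ⟩
      nat u ℚ.* nat m             ≡⟨ cong (nat u ℚ.*_) f ⟩
      nat u ℚ.* (nat p ℚ.* r)     ≡⟨ solve 3 (λ u p r → u :* (p :* r) := u :* r :* p) refl (nat u) (nat p) r ⟩
      nat u ℚ.* r ℚ.* nat p       ≡⟨ cong (ℚ._* nat p) e ⟩
      fromℤ z ℚ.* nat p           ≡⟨ fromℤ-* z (+ p) ⟨
      fromℤ (z ℤ.* + p)           ∎)
      where open ≡-Reasoning

  pDivisible-cancel : ∀ {x} → PDivisible p (nat p ℚ.* x) → PIntegral p x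
  pDivisible-cancel (r , pr , e) = subst (PIntegral p) (sym (nat-cancel p e)) pr

-- Bernoulli numbers as an exponential series.

module Hℚ = Hurwitz (CommutativeRing.commutativeSemiring ℚₚ.+-*-commutativeRing)
open Hℚ using (_⋆_; conv; E; ι; δ; X; powerSum; factorial; hat)

invFact : ℕ → ℚ
invFact n = (+ 1 / (n !)) {{n !≢0}}

c : ℕ → ℚ
c n = lastOr 0ℚ (coeffs n)

lastOr-∷ʳ : ∀ d xs x → lastOr d (xs ∷ʳ x) ≡ x
lastOr-∷ʳ d []       x = refl
lastOr-∷ʳ d (y ∷ xs) x = lastOr-∷ʳ y xs x

-- Each list extends its predecessor by one entry, so all are prefixes of the sequence `c`, and the
-- recursion on lists becomes an identity of power series.
coeffs≡ : ∀ n → coeffs n ≡ applyUpTo c (suc n)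
coeffs≡ zero    = refl
coeffs≡ (suc n) = trans (cong₂ _∷ʳ_ (coeffs≡ n) (sym (lastOr-∷ʳ 0ℚ (coeffs n) _))) (applyUpTo-∷ʳ c (suc n))

zipWith-applyUpTo : ∀ (t : ℕ → ℚ → ℚ) f g n →
  zipWith t (applyUpTo f n) (applyUpTo g n) ≡ applyUpTo (λ k → t (f k) (g k)) n
zipWith-applyUpTo t f g zero    = refl
zipWith-applyUpTo t f g (suc n) = cong (t (f 0) (g 0) ∷_) (zipWith-applyUpTo t (f ∘ suc) (g ∘ suc) n)

-- The last term of the Cauchy product stands apart because it holds the entry that the recursion
-- defines.
sum-conv : ∀ n f g u → (∀ k → k ≤ n → u k ≡ f k ℚ.* g (suc n ∸ k)) →
           sumℚ (applyUpTo u (suc n)) ℚ.+ f (suc n) ℚ.* g 0 ≡ conv f g (suc n)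
sum-conv zero    f g u u≡ = cong (ℚ._+ f 1 ℚ.* g 0) (trans (ℚₚ.+-identityʳ (u 0)) (u≡ 0 z≤n))
sum-conv (suc n) f g u u≡ = trans (ℚₚ.+-assoc (u 0) _ _)
  (cong₂ ℚ._+_ (u≡ 0 z≤n) (sum-conv n (f ∘ suc) g (u ∘ suc) (λ k k≤n → u≡ (suc k) (s≤s k≤n))))

-- The newest entry is minus the sum of the other terms, and its own weight is 1/1! = 1, so
-- everything cancels.
conv-c : ∀ n → conv c (invFact ∘ suc) n ≡ δ n
conv-c zero    = refl
conv-c (suc n) = begin
  conv c (invFact ∘ suc) (suc n)
    ≡⟨ sum-conv n c (invFact ∘ suc) u (λ k k≤n → cong (λ m → c k ℚ.* invFact m) (ℕₚ.+-∸-assoc 1 (ℕₚ.m≤n⇒m≤1+n k≤n))) ⟨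
  s ℚ.+ c (suc n) ℚ.* invFact 1
    ≡⟨ cong (s ℚ.+_) (ℚₚ.*-identityʳ (c (suc n))) ⟩
  s ℚ.+ c (suc n)
    ≡⟨ cong (s ℚ.+_) (trans (lastOr-∷ʳ 0ℚ (coeffs n) _) (cong (ℚ.-_ ∘ sumℚ)
         (trans (cong (zipWith (λ k x → x ℚ.* invFact (suc (suc n) ∸ k)) (upTo (suc n))) (coeffs≡ n))
                (zipWith-applyUpTo (λ k x → x ℚ.* invFact (suc (suc n) ∸ k)) id c (suc n))))) ⟩
  s ℚ.+ ℚ.- s
    ≡⟨ ℚₚ.+-inverseʳ s ⟩
  0ℚ ∎
  where
  open ≡-Reasoning
  u : ℕ → ℚ
  u k = c k ℚ.* invFact (suc (suc n) ∸ k)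
  s = sumℚ (applyUpTo u (suc n))

ι≡nat : ∀ n → ι n ≡ nat n
ι≡nat zero    = refl
ι≡nat (suc n) = trans (cong (1ℚ ℚ.+_) (ι≡nat n)) (sym (nat-+ 1 n))

factorial≡ : ∀ n → factorial n ≡ nat (n !)
factorial≡ zero    = refl
factorial≡ (suc n) = trans (cong₂ ℚ._*_ (ι≡nat (suc n)) (factorial≡ n)) (sym (nat-* (suc n) (n !)))

-- t/(e^t − 1) · (e^t − 1)/t = 1
bernoulli⋆inv : ∀ n → (bernoulli ⋆ inv) n ≡ δ n
bernoulli⋆inv n = begin
  (bernoulli ⋆ inv) n                   ≡⟨ Hℚ.⋆-cong bernoulli≡ inv≡ n ⟩
  (hat c ⋆ hat (invFact ∘ suc)) n       ≡⟨ Hℚ.hat-conv c (invFact ∘ suc) n ⟨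
  factorial n ℚ.* conv c (invFact ∘ suc) n ≡⟨ cong (factorial n ℚ.*_) (conv-c n) ⟩
  factorial n ℚ.* δ n                   ≡⟨ factorial*δ n ⟩
  δ n                                   ∎
  where
  open ≡-Reasoning
  bernoulli≡ : ∀ n → bernoulli n ≡ hat c n
  bernoulli≡ n = cong (ℚ._* c n) (sym (factorial≡ n))
  inv≡ : ∀ n → inv n ≡ hat (invFact ∘ suc) n
  inv≡ n = nat-cancel (suc n) (begin
    nat (suc n) ℚ.* inv n                              ≡⟨ /-inverse (suc n) ⟩
    1ℚ                                                 ≡⟨ /-inverse (suc n !) {{suc n !≢0}} ⟨
    nat (suc n * n !) ℚ.* invFact (suc n)              ≡⟨ cong (ℚ._* invFact (suc n)) (nat-* (suc n) (n !)) ⟩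
    nat (suc n) ℚ.* nat (n !) ℚ.* invFact (suc n)      ≡⟨ ℚₚ.*-assoc (nat (suc n)) (nat (n !)) (invFact (suc n)) ⟩
    nat (suc n) ℚ.* (nat (n !) ℚ.* invFact (suc n))    ≡⟨ cong (λ x → nat (suc n) ℚ.* (x ℚ.* invFact (suc n))) (factorial≡ n) ⟨
    nat (suc n) ℚ.* hat (invFact ∘ suc) n              ∎)
  factorial*δ : ∀ n → factorial n ℚ.* δ n ≡ δ n
  factorial*δ zero    = refl
  factorial*δ (suc n) = ℚₚ.*-zeroʳ (factorial (suc n))

ι-inv : ∀ n → ι (suc n) ℚ.* inv n ≡ 1ℚ
ι-inv n = trans (cong (ℚ._* inv n) (ι≡nat (suc n))) (/-inverse (suc n))

X⋆inv+δ : ∀ n → (X ⋆ inv) n ℚ.+ δ n ≡ E 1ℚ n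
X⋆inv+δ zero    = refl
X⋆inv+δ (suc n) = trans (ℚₚ.+-identityʳ _) (trans (Hℚ.X⋆-suc inv n) (trans (ι-inv n) (sym (E1≡1 (suc n)))))
  where
  E1≡1 : ∀ n → E 1ℚ n ≡ 1ℚ
  E1≡1 zero    = refl
  E1≡1 (suc n) = trans (ℚₚ.*-identityˡ _) (E1≡1 n)

-- (e^{Nt} − 1)/t as an exponential series
inv⋆powerSum : ∀ N n → (inv ⋆ powerSum N) n ≡ inv n ℚ.* E (ι N) (suc n)
inv⋆powerSum N n = begin
  (inv ⋆ powerSum N) n
    ≡⟨ ℚₚ.*-identityˡ _ ⟨
  1ℚ ℚ.* (inv ⋆ powerSum N) n
    ≡⟨ cong (ℚ._* (inv ⋆ powerSum N) n) (trans (ℚₚ.*-comm (inv n) _) (ι-inv n)) ⟨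
  inv n ℚ.* ι (suc n) ℚ.* (inv ⋆ powerSum N) n
    ≡⟨ ℚₚ.*-assoc (inv n) (ι (suc n)) _ ⟩
  inv n ℚ.* (ι (suc n) ℚ.* (inv ⋆ powerSum N) n)
    ≡⟨ cong (inv n ℚ.*_) (Hℚ.X⋆-suc (inv ⋆ powerSum N) n) ⟨
  inv n ℚ.* (X ⋆ (inv ⋆ powerSum N)) (suc n)
    ≡⟨ cong (inv n ℚ.*_) (Hℚ.⋆-assoc X inv (powerSum N) (suc n)) ⟨
  inv n ℚ.* ((X ⋆ inv) ⋆ powerSum N) (suc n)
    ≡⟨ cong (inv n ℚ.*_) (ℚₚ.+-identityʳ _) ⟨
  inv n ℚ.* (((X ⋆ inv) ⋆ powerSum N) (suc n) ℚ.+ 0ℚ)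
    ≡⟨ cong (inv n ℚ.*_) (Hℚ.J⋆powerSum (X ⋆ inv) X⋆inv+δ N (suc n)) ⟩
  inv n ℚ.* E (ι N) (suc n) ∎
  where open ≡-Reasoning

-- Multiply Σ_{a<N} e^{at} by 1 = t/(e^t - 1) · (e^t - 1)/t and reassociate: the second factor turns
-- the sum into (e^{Nt} - 1)/t.
faulhaber : ∀ N n → powerSum N n ≡ (bernoulli ⋆ (λ k → inv k ℚ.* E (ι N) (suc k))) n
faulhaber N n = begin
  powerSum N n                            ≡⟨ Hℚ.⋆-identityˡ (powerSum N) n ⟨
  (δ ⋆ powerSum N) n                      ≡⟨ Hℚ.⋆-cong bernoulli⋆inv (λ _ → refl) n ⟨
  ((bernoulli ⋆ inv) ⋆ powerSum N) n      ≡⟨ Hℚ.⋆-assoc bernoulli inv (powerSum N) n ⟩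
  (bernoulli ⋆ (inv ⋆ powerSum N)) n      ≡⟨ Hℚ.⋆-cong (λ _ → refl) (inv⋆powerSum N) n ⟩
  (bernoulli ⋆ (λ k → inv k ℚ.* E (ι N) (suc k))) n ∎
  where open ≡-Reasoning

E≡nat^ : ∀ a n → E (ι a) n ≡ nat (a ^ n)
E≡nat^ a zero    = refl
E≡nat^ a (suc n) = trans (cong₂ ℚ._*_ (ι≡nat a) (E≡nat^ a n)) (sym (nat-* a (a ^ n)))

powerSum≡nat : ∀ N n → powerSum N n ≡ nat (Hℕ.powerSum N n)
powerSum≡nat zero    n = refl
powerSum≡nat (suc N) n = trans (cong₂ ℚ._+_ (powerSum≡nat N n) (trans (E≡nat^ N n) (cong nat (sym (E-ι≡^ N n)))))
  (sym (nat-+ (Hℕ.powerSum N n) (Hℕ.E (Hℕ.ι N) n)))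

-- Poles of the Bernoulli numbers at p, after von Staudt and Clausen.

module VonStaudt (q : ℕ) (pr : Prime (suc (suc q))) where
  private p = suc (suc q)
  open Local pr
  open PowerSums q pr using (S; p-1∣⇒p∤S; p-1∤⇒p∣S)

  -- `U` is (e^{pt} - 1)/(pt) and `V` is `U` without its constant term 1. The factor p split off
  -- from (e^{pt} - 1)/t has moved into `pB`.
  pB U V : ℕ → ℚ
  pB n = nat p ℚ.* bernoulli n
  U n  = inv n ℚ.* nat (p ^ n)
  V zero    = 0ℚ
  V (suc n) = U (suc n)

  S≡pB⋆U : ∀ n → nat (S n) ≡ (pB ⋆ U) n
  S≡pB⋆U n = begin
    nat (S n)
      ≡⟨ powerSum≡nat p n ⟨
    powerSum p n
      ≡⟨ faulhaber p n ⟩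
    (bernoulli ⋆ (λ k → inv k ℚ.* E (ι p) (suc k))) n
      ≡⟨ Hℚ.⋆-cong (λ _ → refl) T≡pU n ⟩
    (bernoulli ⋆ (λ k → nat p ℚ.* U k)) n
      ≡⟨ Hℚ.⋆-scaleʳ (nat p) bernoulli U n ⟩
    nat p ℚ.* (bernoulli ⋆ U) n
      ≡⟨ Hℚ.⋆-scaleˡ (nat p) bernoulli U n ⟨
    (pB ⋆ U) n ∎
    where
    open ≡-Reasoning
    T≡pU : ∀ k → inv k ℚ.* E (ι p) (suc k) ≡ nat p ℚ.* U k
    T≡pU k = trans (cong (inv k ℚ.*_) (trans (E≡nat^ p (suc k)) (nat-* p (p ^ k))))
      (solve 3 (λ i p x → i :* (p :* x) := p :* (i :* x)) refl (inv k) (nat p) (nat (p ^ k)))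

  ⋆-identityʳ : ∀ f n → (f ⋆ δ) n ≡ f n
  ⋆-identityʳ f n = trans (Hℚ.⋆-comm f δ n) (Hℚ.⋆-identityˡ f n)

  S≡pB+ : ∀ n → nat (S n) ≡ pB n ℚ.+ (pB ⋆ V) n
  S≡pB+ n = trans (S≡pB⋆U n) (trans (Hℚ.⋆-cong (λ _ → refl) U≡δ+V n)
    (trans (Hℚ.⋆-distribˡ pB δ V n) (cong (ℚ._+ (pB ⋆ V) n) (⋆-identityʳ pB n))))
    where
    U≡δ+V : ∀ k → U k ≡ δ k ℚ.+ V k
    U≡δ+V zero    = refl
    U≡δ+V (suc k) = sym (ℚₚ.+-identityˡ (U (suc k)))

  PPart : ℕ → Set
  PPart n = ∃[ e ] ∃[ u ] (n ≡ p ^ e * u × ¬ p ∣ u)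

  p-part : ∀ n → 0 < n → PPart n
  p-part = <-rec _ rec
    where
    rec : ∀ n → (∀ {m} → m < n → 0 < m → PPart m) → 0 < n → PPart n
    rec n ih 0<n with p ∣? n
    ... | no  p∤n = 0 , n , sym (ℕₚ.+-identityʳ n) , p∤n
    ... | yes (divides zero refl) = contradiction 0<n λ ()
    ... | yes (divides k@(suc _) refl) with ih (ℕₚ.m<m*n k p (s≤s (s≤s z≤n))) (s≤s z≤n)
    ...   | e , u , k≡ , p∤u =
            suc e , u , trans (ℕₚ.*-comm k p) (trans (cong (p *_) k≡) (sym (ℕₚ.*-assoc p (p ^ e) u))) , p∤u

  -- Write m + 1 = p^e u with u prime to p. Since p^e ≤ m + 1 < p^(j+1), the exponent e is at most
  -- j, and multiplying by u clears the denominator.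
  p^j/[1+m]-pIntegral : ∀ m j → suc m < p ^ suc j → PIntegral p (inv m ℚ.* nat (p ^ j))
  p^j/[1+m]-pIntegral m j m<p^ with p-part (suc m) (s≤s z≤n)
  ... | e , u , m≡ , p∤u = u , p∤u , + (p ^ (j ∸ e)) , (begin
    nat u ℚ.* (inv m ℚ.* nat (p ^ j))
      ≡⟨ cong (λ x → nat u ℚ.* (inv m ℚ.* x)) (trans (cong nat p^j≡) (nat-* (p ^ e) (p ^ (j ∸ e)))) ⟩
    nat u ℚ.* (inv m ℚ.* (nat (p ^ e) ℚ.* nat (p ^ (j ∸ e))))
      ≡⟨ solve 4 (λ u i a b → u :* (i :* (a :* b)) := a :* u :* i :* b)
           refl (nat u) (inv m) (nat (p ^ e)) (nat (p ^ (j ∸ e))) ⟩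
    nat (p ^ e) ℚ.* nat u ℚ.* inv m ℚ.* nat (p ^ (j ∸ e))
      ≡⟨ cong (λ x → x ℚ.* inv m ℚ.* nat (p ^ (j ∸ e))) (trans (sym (nat-* (p ^ e) u)) (cong nat (sym m≡))) ⟩
    nat (suc m) ℚ.* inv m ℚ.* nat (p ^ (j ∸ e))
      ≡⟨ cong (ℚ._* nat (p ^ (j ∸ e))) (/-inverse (suc m)) ⟩
    1ℚ ℚ.* nat (p ^ (j ∸ e))
      ≡⟨ ℚₚ.*-identityˡ _ ⟩
    nat (p ^ (j ∸ e)) ∎)
    where
    open ≡-Reasoning
    p^e≤ : p ^ e ≤ suc m
    p^e≤ = ∣⇒≤ (divides u (trans m≡ (ℕₚ.*-comm (p ^ e) u)))
    e≤j : e ≤ j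
    e≤j = ℕₚ.≮⇒≥ λ j<e → ℕₚ.<⇒≱ m<p^ (ℕₚ.≤-trans (ℕₚ.^-monoʳ-≤ p j<e) p^e≤)
    p^j≡ : p ^ j ≡ p ^ e * p ^ (j ∸ e)
    p^j≡ = trans (cong (p ^_) (sym (ℕₚ.m+[n∸m]≡n e≤j))) (ℕₚ.^-distribˡ-+-* p e (j ∸ e))

  grow : ∀ {k x} → k < x → suc k < p * x
  grow {k} {x} k<x = begin-strict
    suc k       ≤⟨ k<x ⟩
    x           <⟨ ℕₚ.m<n+m x (ℕₚ.≤-trans (s≤s z≤n) k<x) ⟩
    x + x       ≡⟨ cong (λ y → x + y) (ℕₚ.+-identityʳ x) ⟨
    2 * x       ≤⟨ ℕₚ.*-monoˡ-≤ x {2} {p} (s≤s (s≤s z≤n)) ⟩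
    p * x       ∎
    where open ℕₚ.≤-Reasoning

  1+m<p^[1+m] : ∀ m → suc m < p ^ suc m
  1+m<p^[1+m] zero    = grow {0} {1} (s≤s z≤n)
  1+m<p^[1+m] (suc m) = grow (1+m<p^[1+m] m)

  U-pIntegral : ∀ n → PIntegral p (U n)
  U-pIntegral n = p^j/[1+m]-pIntegral n n (1+m<p^[1+m] n)

  -- One factor p is set aside and p^n must still absorb n + 2. The hypothesis fails only for p = 2
  -- and n = 0.
  U-pDivisible : ∀ n → suc (suc n) < p ^ suc n → PDivisible p (U (suc n))
  U-pDivisible n n< = inv (suc n) ℚ.* nat (p ^ n) , p^j/[1+m]-pIntegral (suc n) n n< ,
    trans (cong (inv (suc n) ℚ.*_) (nat-* p (p ^ n)))
      (solve 3 (λ i p x → i :* (p :* x) := p :* (i :* x)) refl (inv (suc n)) (nat p) (nat (p ^ n)))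

  V-pIntegral : ∀ n → PIntegral p (V n)
  V-pIntegral zero    = nat-pIntegral 0
  V-pIntegral (suc n) = U-pIntegral (suc n)

  -- Strong induction, valid for p = 2 as well: integrality of `V` is enough here, while its
  -- divisibility by p enters only for the residue of pB_n.
  pB-pIntegral : ∀ n → PIntegral p (pB n)
  pB-pIntegral = <-rec _ λ n ih → subst (PIntegral p)
    (trans (cong (ℚ._+ ℚ.- (pB ⋆ V) n) (S≡pB+ n)) (solve 2 (λ x y → x :+ y :+ :- y := x) refl (pB n) ((pB ⋆ V) n)))
    (pIntegral-+ (nat-pIntegral (S n)) (pIntegral-neg (I.⋆-closed₁ pB V n refl (λ k k<n → ih k<n) V-pIntegral)))
    where
    module I = Hℚ.Ideal {PIntegral p} {PIntegral p} {PIntegral p}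
      (subst (PIntegral p)) (nat-pIntegral 0) pIntegral-+ pIntegral-*

  module IDiv = Hℚ.Ideal {PIntegral p} {PDivisible p} {PDivisible p}
    (subst (PDivisible p)) pDivisible-0 pDivisible-+ pDivisible-*ˡ

  pB⋆V-odd : 0 < q → ∀ n → PDivisible p ((pB ⋆ V) n)
  pB⋆V-odd 0<q n = IDiv.⋆-closed pB V n (λ k _ → pB-pIntegral k) V-pDivisible
    where
    big : ∀ n → suc (suc n) < p ^ suc n
    big zero    = subst (2 <_) (sym (ℕₚ.*-identityʳ p)) (s≤s (s≤s 0<q))
    big (suc n) = grow (big n)
    V-pDivisible : ∀ n → PDivisible p (V n)
    V-pDivisible zero    = pDivisible-0
    V-pDivisible (suc n) = U-pDivisible n (big n)

  -- For p = 2 the series V starts with t, whose contribution n · 2 B_{n−1}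
  -- vanishes modulo 2 only for even n.
  pB⋆V-even : q ≡ 0 → ∀ n → 2 ∣ n → PDivisible p ((pB ⋆ V) n)
  pB⋆V-even refl n 2∣n = subst (PDivisible 2)
    (trans (sym (Hℚ.⋆-distribˡ pB X W n)) (Hℚ.⋆-cong (λ _ → refl) (λ k → sym (V≡X+W k)) n))
    (pDivisible-+ (subst (PDivisible 2) (Hℚ.⋆-comm X pB n) (X⋆pB n 2∣n))
      (IDiv.⋆-closed pB W n (λ k _ → pB-pIntegral k) W-pDivisible))
    where
    W : ℕ → ℚ
    W zero          = 0ℚ
    W (suc zero)    = 0ℚ
    W (suc (suc n)) = U (suc (suc n))
    V≡X+W : ∀ k → V k ≡ X k ℚ.+ W k
    V≡X+W zero          = refl
    -- For p = 2 the value `U 1` evaluates to 2/2 = 1.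
    V≡X+W (suc zero)    = refl
    V≡X+W (suc (suc k)) = sym (ℚₚ.+-identityˡ (U (suc (suc k))))
    big : ∀ n → suc (suc (suc n)) < 2 ^ suc (suc n)
    big zero    = s≤s (s≤s (s≤s (s≤s z≤n)))
    big (suc n) = grow (big n)
    W-pDivisible : ∀ n → PDivisible 2 (W n)
    W-pDivisible zero          = pDivisible-0
    W-pDivisible (suc zero)    = pDivisible-0
    W-pDivisible (suc (suc n)) = U-pDivisible (suc n) (big n)
    X⋆pB : ∀ n → 2 ∣ n → PDivisible 2 ((X ⋆ pB) n)
    X⋆pB zero    _   = subst (PDivisible 2) (sym (Hℚ.X⋆-zero pB)) pDivisible-0
    X⋆pB (suc n) 2∣n = subst (PDivisible 2)
      (trans (ℚₚ.*-comm (pB n) (nat (suc n))) (sym (trans (Hℚ.X⋆-suc pB n) (cong (ℚ._* pB n) (ι≡nat (suc n))))))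
      (pDivisible-*ˡ (pB-pIntegral n) (∣⇒pDivisible 2∣n))

  pB⋆V-pDivisible : ∀ n → 0 < q ⊎ 2 ∣ n → PDivisible p ((pB ⋆ V) n)
  pB⋆V-pDivisible n (inj₁ 0<q) = pB⋆V-odd 0<q n
  pB⋆V-pDivisible n (inj₂ 2∣n) = case q ℕ.≟ 0 of λ where
    (yes q≡0) → pB⋆V-even q≡0 n 2∣n
    (no  q≢0) → pB⋆V-odd (ℕₚ.n≢0⇒n>0 q≢0) n

  bernoulli-pIntegral : ∀ n → 0 < q → ¬ suc q ∣ n → PIntegral p (bernoulli n)
  bernoulli-pIntegral n 0<q ∤n = pDivisible-cancel (subst (PDivisible p)
    (trans (cong (ℚ._+ (ℚ.- 1ℚ) ℚ.* (pB ⋆ V) n) (S≡pB+ n))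
      (solve 2 (λ x y → x :+ y :+ con (ℚ.- 1ℚ) :* y := x) refl (pB n) ((pB ⋆ V) n)))
    (pDivisible-+ (∣⇒pDivisible (p-1∤⇒p∣S n ∤n)) (pDivisible-*ˡ (fromℤ-pIntegral -[1+ 0 ]) (pB⋆V-odd 0<q n))))

  -- Otherwise pB_n and the correction `(pB ⋆ V) n` would both be divisible by p, and with them S_n,
  -- which is -1 modulo p.
  bernoulli-not-pIntegral : ∀ n → 0 < n → suc q ∣ n → 0 < q ⊎ 2 ∣ n → ¬ PIntegral p (bernoulli n)
  bernoulli-not-pIntegral n 0<n ∣n odd int = p-1∣⇒p∤S n 0<n ∣n (pDivisible⇒∣ (subst (PDivisible p) (sym (S≡pB+ n))
    (pDivisible-+ (bernoulli n , int , refl) (pB⋆V-pDivisible n odd))))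

-- From poles at each prime to the denominator of the polynomial.

integral-locally : ∀ {q} → (∀ {p} → Prime p → PIntegral p q) → IsIntegral q
integral-locally {q} local = decidable-stable (↧ₙ q ℕ.≟ 1) λ ↧≢1 →
  let p , pr , p∣↧ = ∃-prime-divisor (↧ₙ q) ↧≢1 in pIntegral⇒∤↧ (local pr) p∣↧

-- Simple poles at the listed primes and none elsewhere make the product a scaling factor. For
-- minimality, a scaling factor `e` prime to some listed p would itself witness that the coefficient
-- with a pole is p-integral; so every listed prime divides `e`, and hence their product does.
isDenomPoly : ∀ {f ps} → Unique ps → All Prime ps →
  (∀ {p} → p ∈ ps → All (λ a → PIntegral p (nat p ℚ.* a)) f) →
  (∀ {p} → Prime p → p ∉ ps → All (PIntegral p) f) →
  (∀ {p} → p ∈ ps → Any (λ a → ¬ PIntegral p a) f) →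
  IsDenomPoly f (product ps)
isDenomPoly {f} {ps} uniq prs p-simple p-integral p-pole =
  ℕ.>-nonZero⁻¹ (product ps) {{ps≢0}} , All.tabulate scaled , minimal
  where
  ps≢0 = productOfPrimes≢0 prs
  scaled : ∀ {a} → a ∈ f → IsIntegral (nat (product ps) ℚ.* a)
  scaled {a} a∈f = integral-locally local
    where
    local : ∀ {p} → Prime p → PIntegral p (nat (product ps) ℚ.* a)
    local {p} pr = case p ∈? ps of λ where
        (no  p∉ps) → pIntegral-* (nat-pIntegral (product ps)) (All.lookup (p-integral pr p∉ps) a∈f)
        (yes p∈ps) → subst (λ d → PIntegral p (nat d ℚ.* a)) (sym (m∣n⇒n≡quotient*m (∈⇒∣product p∈ps)))
          (*-pIntegral (quotient (∈⇒∣product p∈ps)) (All.lookup (p-simple p∈ps) a∈f))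
      where open Local pr
  minimal : ∀ e → 0 < e → ScalesToℤ[x] e f → product ps ≤ e
  minimal e 0<e scales = ∣⇒≤ {{ℕ.>-nonZero 0<e}} (product-∣ uniq prs divisor)
    where
    divisor : ∀ {p} → p ∈ ps → p ∣ e
    divisor {p} p∈ps = case ((p ∣? e) ,′ find (p-pole p∈ps)) of λ where
      (yes p∣e , _)              → p∣e
      (no  p∤e , a , a∈f , pole) → contradiction
        (e , p∤e , ↥ (nat e ℚ.* a) , integral⇒fromℤ (All.lookup scales a∈f)) pole

coeff : ℕ → ℕ → ℚ
coeff n k = nat (n C k) ℚ.* bernoulli k

bernoulliPoly-All⁺ : ∀ {P : ℚ → Set} n → (∀ {k} → k ≤ n → P (coeff n k)) → All P (bernoulliPoly n)
bernoulliPoly-All⁺ n Pc = All.map⁺ (All.applyUpTo⁺₁ id (suc n) (λ {j} _ → Pc (ℕₚ.m∸n≤m n j)))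

bernoulliPoly-All⁻ : ∀ {P : ℚ → Set} n → All P (bernoulliPoly n) → ∀ {k} → k ≤ n → P (coeff n k)
bernoulliPoly-All⁻ {P} n all {k} k≤n = subst (P ∘ coeff n) (ℕₚ.m∸[m∸n]≡n k≤n)
  (All.applyUpTo⁻ id (suc n) (All.map⁻ all) {n ∸ k} (s≤s (ℕₚ.m∸n≤m n k)))

-- The conditions of the odd and the even case in one: for n odd, p − 1 ∣ n
-- forces p = 2, and the bounds on p follow from p ≤ s_p(n).
DenomPrime : ℕ → ℕ → Set
DenomPrime n p = p ≡ 2 ⊎ (p ∸ 1) ∣ n ⊎ p ≤ digitSum p n

denomPrime? : ∀ n → Decidable (DenomPrime n)
denomPrime? n p = (p ℕ.≟ 2) ⊎-dec (((p ∸ 1) ∣? n) ⊎-dec (p ℕ.≤? digitSum p n))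

module Coefficients (n q : ℕ) (0<n : 0 < n) (pr : Prime (suc (suc q))) where
  private p = suc (suc q)
  open Local pr
  open VonStaudt q pr
  open Digits q

  simple-pole : ∀ k → PIntegral p (nat p ℚ.* coeff n k)
  simple-pole k = subst (PIntegral p)
    (trans (sym (ℚₚ.*-assoc (nat (n C k)) (nat p) (bernoulli k)))
      (trans (cong (ℚ._* bernoulli k) (ℚₚ.*-comm (nat (n C k)) (nat p)))
        (ℚₚ.*-assoc (nat p) (nat (n C k)) (bernoulli k))))
    (pIntegral-* (nat-pIntegral (n C k)) (pB-pIntegral k))

  coeff-not-pIntegral : ∀ k → 0 < k → suc q ∣ k → 0 < q ⊎ 2 ∣ k → ¬ p ∣ n C k → ¬ PIntegral p (coeff n k)
  coeff-not-pIntegral k 0<k ∣k odd ∤C = bernoulli-not-pIntegral k 0<k ∣k odd ∘ pIntegral-unscale ∤C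

  p∤nCn : ¬ p ∣ n C n
  p∤nCn p∣ = ¬prime[1] (subst Prime (∣1⇒≡1 (subst (p ∣_) (nCn≡1 n) p∣)) pr)

  HasPole : Set
  HasPole = ∃[ k ] (k ≤ n × ¬ PIntegral p (coeff n k))

  pole-n : 0 < q ⊎ 2 ∣ n → suc q ∣ n → HasPole
  pole-n even ∣n = n , ℕₚ.≤-refl , coeff-not-pIntegral n 0<n ∣n even p∤nCn

  pole-k : 0 < q → p ≤ digitSum p n → HasPole
  pole-k 0<q p≤s = let k , 0<k , k<n , ∣k , ∤C = p≤digitSum⇒∃ pr n p≤s
    in k , ℕₚ.<⇒≤ k<n , coeff-not-pIntegral k 0<k ∣k (inj₁ 0<q) ∤C

  -- The first hypothesis leaves out exactly p = 2 with odd n, the case of `pole₂`. For p = 2 and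
  -- even n the index k = n always serves.
  pole : 0 < q ⊎ 2 ∣ n → DenomPrime n p → HasPole
  pole (inj₁ 0<q) (inj₁ refl)       = contradiction 0<q λ ()
  pole (inj₂ 2∣n) (inj₁ refl)       = pole-n (inj₂ 2∣n) (1∣ n)
  pole even       (inj₂ (inj₁ ∣n))  = pole-n even ∣n
  pole (inj₁ 0<q) (inj₂ (inj₂ p≤s)) = pole-k 0<q p≤s
  pole (inj₂ 2∣n) (inj₂ (inj₂ p≤s)) = case q ℕ.≟ 0 of λ where
    (yes q≡0) → pole-n (inj₂ 2∣n) (subst (λ q → suc q ∣ n) (sym q≡0) (1∣ n))
    (no  q≢0) → pole-k (ℕₚ.n≢0⇒n>0 q≢0) p≤s

  -- For k > 0 either B_k is p-integral, or p ∣ C(n,k) cancels its simple pole, or `DenomPrime n p`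
  -- would hold: by the digit sum if k < n, by p - 1 ∣ n if k = n.
  no-pole : ¬ DenomPrime n p → ∀ k → k ≤ n → PIntegral p (coeff n k)
  -- A separate case, since p - 1 divides 0 although B_0 = 1 has no pole.
  no-pole ∤D zero    k≤n = nat-pIntegral 1
  no-pole ∤D k@(suc _) k≤n = case ((suc q ∣? k) ,′ (p ∣? n C k)) of λ where
    (no  ∤k , _)      → pIntegral-* (nat-pIntegral (n C k))
                          (bernoulli-pIntegral k (ℕₚ.n≢0⇒n>0 (∤D ∘ inj₁ ∘ cong (λ m → suc (suc m)))) ∤k)
    (yes ∣k , yes ∣C) → subst (λ c → PIntegral p (nat c ℚ.* bernoulli k)) (sym (m∣n⇒n≡quotient*m ∣C))
                          (*-pIntegral (quotient ∣C) (pB-pIntegral k))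
    (yes ∣k , no  ∤C) → case ℕₚ.m≤n⇒m<n∨m≡n k≤n of λ where
      (inj₁ k<n) → contradiction (inj₂ (inj₂ (∃⇒p≤digitSum pr n k (s≤s z≤n) k<n ∣k ∤C))) ∤D
      (inj₂ k≡n) → contradiction (inj₂ (inj₁ (subst (suc q ∣_) k≡n ∣k))) ∤D

-- C(n,1) B₁ = −n/2
pole₂ : ∀ n → 2 ∣ suc n → ¬ PIntegral 2 (coeff n 1)
-- `∣-refl` applies because the denominator of `bernoulli 1` evaluates to 2.
pole₂ n 2∣1+n int = pIntegral⇒∤↧ (Local.pIntegral-unscale prime[2] 2∤C int) ∣-refl
  where
  2∤C : ¬ 2 ∣ n C 1
  2∤C 2∣C = ¬even∧odd n (subst (2 ∣_) (nC1≡n n) 2∣C) 2∣1+n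

denomPole : ∀ n {p} → 0 < n → Prime p → DenomPrime n p → ∃[ k ] (k ≤ n × ¬ PIntegral p (coeff n k))
denomPole n {zero}        0<n pr D = contradiction pr ¬prime[0]
denomPole n {suc zero}    0<n pr D = contradiction pr ¬prime[1]
denomPole n {suc (suc (suc q))} 0<n pr D = Coefficients.pole n (suc q) 0<n pr (inj₁ (s≤s z≤n)) D
denomPole n {suc (suc zero)} 0<n pr D =
  [ (λ 2∣n → Coefficients.pole n 0 0<n pr (inj₂ 2∣n) D) , (λ 2∣1+n → 1 , 0<n , pole₂ n 2∣1+n) ]′ (even⊎odd n)

-- The list is left open so that the single prime 2, the product for odd n and the concatenated
-- products for even n are all instances.
isDenom-bernoulliPoly : ∀ n {ps} → 0 < n → Unique ps → (∀ {p} → p ∈ ps → Prime p × DenomPrime n p) →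
  (∀ {p} → Prime p → DenomPrime n p → p ∈ ps) → IsDenomPoly (bernoulliPoly n) (product ps)
isDenom-bernoulliPoly n {ps} 0<n uniq sound complete =
  isDenomPoly uniq (All.tabulate (proj₁ ∘ sound)) simple regular poles
  where
  simple : ∀ {p} → p ∈ ps → All (λ a → PIntegral p (nat p ℚ.* a)) (bernoulliPoly n)
  simple {zero}        p∈ = contradiction (proj₁ (sound p∈)) ¬prime[0]
  simple {suc zero}    p∈ = contradiction (proj₁ (sound p∈)) ¬prime[1]
  simple {suc (suc q)} p∈ = bernoulliPoly-All⁺ n λ {k} _ → Coefficients.simple-pole n q 0<n (proj₁ (sound p∈)) k
  regular : ∀ {p} → Prime p → p ∉ ps → All (PIntegral p) (bernoulliPoly n)
  regular {zero}        pr p∉ = contradiction pr ¬prime[0]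
  regular {suc zero}    pr p∉ = contradiction pr ¬prime[1]
  regular {suc (suc q)} pr p∉ = bernoulliPoly-All⁺ n λ {k} → Coefficients.no-pole n q 0<n pr (p∉ ∘ complete pr) k
  poles : ∀ {p} → p ∈ ps → Any (λ a → ¬ PIntegral p a) (bernoulliPoly n)
  poles {p} p∈ = let k , k≤n , pole = denomPole n 0<n (proj₁ (sound p∈)) (proj₂ (sound p∈))
    in lose (bernoulliPoly-All⁻ {_∈ bernoulliPoly n} n (All.tabulate id) k≤n) pole

-- Lists of primes and the assertions of the theorem.

p-1∣n⇒p≤1+n : ∀ {p n} → 0 < n → (p ∸ 1) ∣ n → p ≤ suc n
p-1∣n⇒p≤1+n {p} 0<n ∣n = ℕₚ.≤-trans (ℕₚ.m≤n+m∸n p 1) (s≤s (∣⇒≤ {{ℕ.>-nonZero 0<n}} ∣n))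

denomPrime⇒≤ : ∀ {n p} → 0 < n → Prime p → DenomPrime n p → p ≤ suc n
denomPrime⇒≤ 0<n pr (inj₁ refl)        = s≤s 0<n
denomPrime⇒≤ 0<n pr (inj₂ (inj₁ ∣n))   = p-1∣n⇒p≤1+n 0<n ∣n
denomPrime⇒≤ {n} 0<n pr (inj₂ (inj₂ p≤s)) = ℕₚ.m≤n⇒m≤1+n (ℕₚ.≤-trans p≤s (digitSum-≤ pr n))

primesWith : (N : ℕ) {P : Pred ℕ 0ℓ} → Decidable P → List ℕ
primesWith N P? = filter (λ p → prime? p ×-dec P? p) (upTo (suc N))

primesWith-unique : ∀ N {P : Pred ℕ 0ℓ} (P? : Decidable P) → Unique (primesWith N P?)
primesWith-unique N P? = Unique.filter⁺ (λ p → prime? p ×-dec P? p) (Unique.upTo⁺ (suc N))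

∈primesWith⁻ : ∀ N {P : Pred ℕ 0ℓ} (P? : Decidable P) {p} → p ∈ primesWith N P? → Prime p × P p
∈primesWith⁻ N P? p∈ = proj₂ (∈-filter⁻ (λ p → prime? p ×-dec P? p) {xs = upTo (suc N)} p∈)

∈primesWith⁺ : ∀ N {P : Pred ℕ 0ℓ} (P? : Decidable P) {p} → p ≤ N → Prime p → P p → p ∈ primesWith N P?
∈primesWith⁺ N P? p≤N pr Pp = ∈-filter⁺ (λ p → prime? p ×-dec P? p) (∈-upTo⁺ (s≤s p≤N)) (pr , Pp)

denomPrimes : ℕ → List ℕ
denomPrimes n = primesWith (suc n) (denomPrime? n)

∈denomPrimes : ∀ {n p} → 0 < n → Prime p → DenomPrime n p → p ∈ denomPrimes n
∈denomPrimes {n} 0<n pr D = ∈primesWith⁺ (suc n) (denomPrime? n) (denomPrime⇒≤ 0<n pr D) pr D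

-- Two least scaling factors bound each other. The resulting formula, uniform in n, yields parity,
-- squarefreeness and unboundedness.
denom≡ : ∀ n {d} → 0 < n → IsDenomPoly (bernoulliPoly n) d → d ≡ product (denomPrimes n)
denom≡ n {d} 0<n (0<d , scales , minimal) =
  let 0<D , scalesD , minimalD = isDenom-bernoulliPoly n 0<n (primesWith-unique (suc n) (denomPrime? n))
        (∈primesWith⁻ (suc n) (denomPrime? n)) (∈denomPrimes 0<n)
  in ℕₚ.≤-antisym (minimal _ 0<D scalesD) (minimalD d 0<d scales)

denom-one : IsDenomPoly (bernoulliPoly 1) 2
denom-one = isDenom-bernoulliPoly 1 {2 ∷ []} (s≤s z≤n) ([] ∷ []) sound complete
  where
  sound : ∀ {p} → p ∈ 2 ∷ [] → Prime p × DenomPrime 1 p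
  sound (here refl) = prime[2] , inj₁ refl
  1<p : ∀ {p} → Prime p → 1 < p
  1<p {p} pr = ℕ.nonTrivial⇒n>1 p {{prime⇒nonTrivial pr}}
  complete : ∀ {p} → Prime p → DenomPrime 1 p → p ∈ 2 ∷ []
  complete pr (inj₁ refl)         = here refl
  complete pr (inj₂ (inj₁ p-1∣1)) = here (ℕₚ.≤-antisym (p-1∣n⇒p≤1+n (s≤s z≤n) p-1∣1) (1<p pr))
  complete pr (inj₂ (inj₂ p≤s))   = contradiction (ℕₚ.≤-trans p≤s (digitSum-≤ pr 1)) (ℕₚ.<⇒≱ (1<p pr))

denom-odd : ∀ k → 1 ≤ k → IsDenomPoly (bernoulliPoly (2 * k + 1))
  (primeProd (2 * k + 2) (CondOdd (2 * k + 1)) (condOdd? (2 * k + 1)))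
denom-odd k 1≤k = isDenom-bernoulliPoly n 0<n (primesWith-unique N (condOdd? n)) sound complete
  where
  n = 2 * k + 1
  N = 2 * k + 2
  0<n : 0 < n
  0<n = ℕₚ.m≤n+m 1 (2 * k)
  1+n≡n+1 : suc n ≡ n + 1
  1+n≡n+1 = ℕₚ.+-comm 1 n
  sound : ∀ {p} → p ∈ primesWith N (condOdd? n) → Prime p × DenomPrime n p
  sound p∈ = let pr , _ , p≤s = ∈primesWith⁻ N (condOdd? n) p∈ in pr , inj₂ (inj₂ p≤s)
  2∤n : ¬ 2 ∣ n
  2∤n 2∣n = ¬even∧odd (2 * k) (m∣m*n k) (subst (2 ∣_) (ℕₚ.+-comm (2 * k) 1) 2∣n)
  member : ∀ {p} → Prime p → p ≤ digitSum p n → p ∈ primesWith N (condOdd? n)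
  member {p} pr p≤s = ∈primesWith⁺ N (condOdd? n) p≤N pr (subst (2 * p ≤_) 1+n≡n+1 2p≤ , p≤s)
    where
    2p≤ = p≤digitSum⇒2p≤1+n pr n p≤s
    p≤N : p ≤ N
    p≤N = subst (p ≤_) (sym (ℕₚ.+-suc (2 * k) 1)) (ℕₚ.≤-trans (ℕₚ.m≤m+n p (p + 0)) 2p≤)
  complete : ∀ {p} → Prime p → DenomPrime n p → p ∈ primesWith N (condOdd? n)
  complete {p} pr D = case p ℕ.≟ 2 of λ where
      (yes p≡2) → subst (_∈ primesWith N (condOdd? n)) (sym p≡2)
        (member prime[2] (subst (λ m → 2 ≤ digitSum 2 (m + 1)) (ℕₚ.*-comm k 2) (2≤digitSum₂ k 1≤k)))
      (no p≢2) → [ (λ p≡2 → contradiction p≡2 p≢2)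
                 , [ (λ p-1∣n → contradiction (∣-trans (odd-prime⇒2∣p-1 pr p≢2) p-1∣n) 2∤n) , member pr ]′ ]′ D

-- Since 1 ∣ n, the prime 2 falls into the first product, so the bound 3p ≤ n + 1 has to be proved
-- for odd primes only.
denom-even : ∀ k → 1 ≤ k → IsDenomPoly (bernoulliPoly (2 * k))
  (primeProd (2 * k + 1) (CondDiv (2 * k)) (condDiv? (2 * k))
    * primeProd (2 * k + 1) (CondEven (2 * k)) (condEven? (2 * k)))
denom-even k 1≤k = subst (IsDenomPoly (bernoulliPoly n)) (product-++ ps qs)
  (isDenom-bernoulliPoly n 0<n
    (Unique.++⁺ (primesWith-unique N (condDiv? n)) (primesWith-unique N (condEven? n)) disjoint) sound complete)
  where
  n = 2 * k
  N = 2 * k + 1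
  0<n : 0 < n
  0<n = ℕₚ.≤-trans 1≤k (ℕₚ.m≤m+n k (k + 0))
  ps = primesWith N (condDiv? n)
  qs = primesWith N (condEven? n)
  disjoint : ∀ {p} → ¬ (p ∈ ps × p ∈ qs)
  disjoint (p∈ps , p∈qs) = proj₁ (proj₂ (∈primesWith⁻ N (condEven? n) p∈qs)) (proj₂ (∈primesWith⁻ N (condDiv? n) p∈ps))
  sound : ∀ {p} → p ∈ ps ++ qs → Prime p × DenomPrime n p
  sound p∈ = case ∈-++⁻ ps p∈ of λ where
    (inj₁ p∈ps) → let pr , p-1∣n = ∈primesWith⁻ N (condDiv? n) p∈ps in pr , inj₂ (inj₁ p-1∣n)
    (inj₂ p∈qs) → let pr , _ , _ , p≤s = ∈primesWith⁻ N (condEven? n) p∈qs in pr , inj₂ (inj₂ p≤s)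
  complete : ∀ {p} → Prime p → DenomPrime n p → p ∈ ps ++ qs
  complete {p} pr D = case condDiv? n p of λ where
      (yes p-1∣n) → ∈-++⁺ˡ (∈primesWith⁺ N (condDiv? n) p≤N pr p-1∣n)
      (no  p-1∤n) → ∈-++⁺ʳ ps (∈primesWith⁺ N (condEven? n) p≤N pr (condEven p-1∤n))
    where
    condEven : ¬ (p ∸ 1) ∣ n → CondEven n p
    condEven p-1∤n = p-1∤n ,
      [ (λ p≡2 → contradiction p≡2 p≢2)
      , [ (λ p-1∣n → contradiction p-1∣n p-1∤n)
        , (λ p≤s → subst (3 * p ≤_) (ℕₚ.+-comm 1 n) (p≤digitSum⇒3p≤1+n pr p≢2 n (m∣m*n k) p≤s) , p≤s) ]′ ]′ D
      where
      p≢2 : p ≢ 2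
      p≢2 p≡2 = p-1∤n (subst (λ p → p ∸ 1 ∣ n) (sym p≡2) (1∣ n))
    p≤N : p ≤ N
    p≤N = subst (p ≤_) (ℕₚ.+-comm 1 n) (denomPrime⇒≤ 0<n pr D)

denom-even∧squareFree : ∀ n d → 1 ≤ n → IsDenomPoly (bernoulliPoly n) d → 2 ∣ d × SquareFree d
denom-even∧squareFree n d 0<n isDenom = subst (λ d → 2 ∣ d × SquareFree d) (sym (denom≡ n 0<n isDenom))
  ( ∈⇒∣product (∈denomPrimes 0<n prime[2] (inj₁ refl))
  , product-squareFree (primesWith-unique (suc n) (denomPrime? n))
      (All.tabulate (proj₁ ∘ ∈primesWith⁻ (suc n) (denomPrime? n))))

-- For n = p - 1 the condition p - 1 ∣ n puts p itself into the denominator, and p can be taken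
-- beyond any bound.
denom-unbounded : ∀ M → ∃[ n ] (1 ≤ n × (∀ d → IsDenomPoly (bernoulliPoly n) d → M < d))
denom-unbounded M = let p , pr , M<p = ∃-larger-prime M in p ∸ 1 , 0<p-1 pr , λ d isDenom →
  ℕₚ.<-≤-trans M<p (∣⇒≤ {{ℕ.>-nonZero (proj₁ isDenom)}} (p∣d pr isDenom))
  where
  0<p-1 : ∀ {p} → Prime p → 0 < p ∸ 1
  0<p-1 {p} pr = ℕₚ.m<n⇒0<n∸m (ℕ.nonTrivial⇒n>1 p {{prime⇒nonTrivial pr}})
  p∣d : ∀ {p d} → Prime p → IsDenomPoly (bernoulliPoly (p ∸ 1)) d → p ∣ d
  p∣d {p} pr isDenom = subst (p ∣_) (sym (denom≡ (p ∸ 1) (0<p-1 pr) isDenom))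
    (∈⇒∣product (∈denomPrimes (0<p-1 pr) pr (inj₂ (inj₁ ∣-refl))))

-- B_n is itself a coefficient, the constant term with k = n and C(n,n) = 1.
denom-bernoulli-∣ : ∀ n d → 1 ≤ n → IsDenomPoly (bernoulliPoly n) d → ↧ₙ (bernoulli n) ∣ d
denom-bernoulli-∣ n d 0<n (_ , scales , _) = denominator-∣ d (bernoulli n) (↥ (nat d ℚ.* coeff n n)) (begin
  nat d ℚ.* bernoulli n                    ≡⟨ cong (nat d ℚ.*_) (ℚₚ.*-identityˡ (bernoulli n)) ⟨
  nat d ℚ.* (nat 1 ℚ.* bernoulli n)        ≡⟨ cong (λ m → nat d ℚ.* (nat m ℚ.* bernoulli n)) (nCn≡1 n) ⟨
  nat d ℚ.* coeff n n
    ≡⟨ integral⇒fromℤ (bernoulliPoly-All⁻ {λ a → IsIntegral (nat d ℚ.* a)} n scales ℕₚ.≤-refl) ⟩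
  fromℤ (↥ (nat d ℚ.* coeff n n))          ∎)
  where open ≡-Reasoning

theorem4 : IsDenomPoly (bernoulliPoly 1) 2
    × (∀ k → 1 ≤ k → IsDenomPoly (bernoulliPoly (2 * k + 1)) (primeProd (2 * k + 2) (CondOdd (2 * k + 1)) (condOdd? (2 * k + 1))))
    × (∀ k → 1 ≤ k → IsDenomPoly (bernoulliPoly (2 * k)) (primeProd (2 * k + 1) (CondDiv (2 * k)) (condDiv? (2 * k)) * primeProd (2 * k + 1) (CondEven (2 * k)) (condEven? (2 * k))))
    × (∀ n d → 1 ≤ n → IsDenomPoly (bernoulliPoly n) d → 2 ∣ d × SquareFree d)
    × (∀ M → ∃[ n ] (1 ≤ n × (∀ d → IsDenomPoly (bernoulliPoly n) d → M < d)))
    × (∀ n d → 1 ≤ n → IsDenomPoly (bernoulliPoly n) d → ↧ₙ (bernoulli n) ∣ d)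
theorem4 = denom-one , denom-odd , denom-even , denom-even∧squareFree , denom-unbounded , denom-bernoulli-∣
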